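{- Let $p$ and $q$ be distinct primes satisfying $p \equiv 33 \pmod{40}$ and $q \equiv 7 \pmod{40}$. Then the torsion subgroup $E_{pq}(\mathbb{Q})_{tors}$ of the elliptic curve $E_{pq}: y^2 = x^3 - 5pqx$ over $\mathbb{Q}$ is isomorphic to $\mathbb{Z}/2\mathbb{Z}$.
   Context: $E(\mathbb{Q})_{tors}$ denotes the subgroup of elements of finite order in the group $E(\mathbb{Q})$ of rational points. -}

module Defs where

open import Algebra.Bundles using (RawGroup; Group)
open import Algebra.Morphism.Structures using (module GroupMorphisms)
import Algebra.Definitions.RawMonoid as RawMonoidDefinitions
import Data.Integer.Base as ℤ
open import Data.Nat.Base as ℕ using (ℕ)
import Data.Nat.Properties as ℕ
import Data.Parity.Properties as Parity
open import Data.Nat.Coprimality using (1-coprimeTo) renaming (sym to sym-coprime)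
open import Data.Nat.Primality using (Prime; prime⇒nonZero)
open import Data.Product.Base using (Σ; Σ-syntax; ∃-syntax; _×_; _,_; proj₁)
open import Data.Rational.Base
  using (ℚ; 0ℚ; 1ℚ; _+_; _*_; _-_; -_; _÷_; 1/_; _/_; NonZero; ≢-nonZero)
open import Data.Rational.Properties
open import Data.Rational.Solver using (module +-*-Solver)
open import Level using (Level; 0ℓ; _⊔_)
open import Relation.Binary.PropositionalEquality
open import Relation.Nullary using (yes; no; recompute)
open import Relation.Unary using (Pred)

open +-*-Solver using (solve; _:=_; _:+_; _:*_; _:-_; :-_; con)

private
  variable
    c ℓ c′ ℓ′ p : Level

module _ (G : RawGroup c ℓ) where
  open RawGroup G
  open RawMonoidDefinitions rawMonoid using () renaming (_×_ to _·_)

  IsTorsion : Pred Carrier ℓ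
  IsTorsion x = ∃[ n ] (ℕ.NonZero n × n · x ≈ ε)

  record IsSubgroup (P : Pred Carrier p) : Set (c ⊔ p) where
    field
      ∙-closed  : ∀ {x y} → P x → P y → P (x ∙ y)
      ε-closed  : P ε
      ⁻¹-closed : ∀ {x} → P x → P (x ⁻¹)

  -- Elements are compared in G: the membership proofs play no role.
  subgroup : {P : Pred Carrier p} → IsSubgroup P → RawGroup (c ⊔ p) ℓ
  subgroup {P = P} H = record
    { Carrier = Σ Carrier P
    ; _≈_     = λ x y → proj₁ x ≈ proj₁ y
    ; _∙_     = λ (x , px) (y , py) → x ∙ y , ∙-closed px py
    ; ε       = ε , ε-closed
    ; _⁻¹     = λ (x , px) → x ⁻¹ , ⁻¹-closed px
    }
    where open IsSubgroup H

infix 4 _≅_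

_≅_ : RawGroup c ℓ → RawGroup c′ ℓ′ → Set (c ⊔ ℓ ⊔ c′ ⊔ ℓ′)
G ≅ H = Σ[ φ ∈ (RawGroup.Carrier G → RawGroup.Carrier H) ] IsGroupIsomorphism φ
  where open GroupMorphisms G H using (IsGroupIsomorphism)

fromℕ : ℕ → ℚ
fromℕ n = ℤ.+ n / 1

private
  ÷-cancel : ∀ u v .{{_ : NonZero v}} → (u ÷ v) * v ≡ u
  ÷-cancel u v = begin
    u * 1/ v * v    ≡⟨ *-assoc u (1/ v) v ⟩
    u * (1/ v * v)  ≡⟨ cong (u *_) (*-inverseˡ v) ⟩
    u * 1ℚ          ≡⟨ *-identityʳ u ⟩
    u               ∎
    where open ≡-Reasoning

  *-cancelʳ-0 : ∀ {u v} → v ≢ 0ℚ → u * v ≡ 0ℚ → u ≡ 0ℚ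
  *-cancelʳ-0 {u} {v} v≢0 uv≡0 = begin
    u               ≡⟨ *-identityʳ u ⟨
    u * 1ℚ          ≡⟨ cong (u *_) (*-inverseʳ v) ⟨
    u * (v * 1/ v)  ≡⟨ *-assoc u v (1/ v) ⟨
    u * v * 1/ v    ≡⟨ cong (_* 1/ v) uv≡0 ⟩
    0ℚ * 1/ v       ≡⟨ *-zeroˡ (1/ v) ⟩
    0ℚ              ∎
    where
    open ≡-Reasoning
    instance _ = ≢-nonZero v≢0

  *-≢0 : ∀ {u v} → u ≢ 0ℚ → v ≢ 0ℚ → u * v ≢ 0ℚ
  *-≢0 u≢0 v≢0 uv≡0 = u≢0 (*-cancelʳ-0 v≢0 uv≡0)

  -‿≡0 : ∀ u v → u - v ≡ 0ℚ → u ≡ v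
  -‿≡0 u v u-v≡0 = begin
    u            ≡⟨ solve 2 (λ u v → u := (u :- v) :+ v) refl u v ⟩
    (u - v) + v  ≡⟨ cong (_+ v) u-v≡0 ⟩
    0ℚ + v       ≡⟨ +-identityˡ v ⟩
    v            ∎
    where open ≡-Reasoning

  ≡⇒-‿≡0 : ∀ {u v} → u ≡ v → u - v ≡ 0ℚ
  ≡⇒-‿≡0 {u} refl = +-inverseʳ u

  fromℕ≢0 : ∀ n .{{_ : ℕ.NonZero n}} → fromℕ n ≢ 0ℚ
  fromℕ≢0 (ℕ.suc n) eq
    with () ← trans (sym (normalize-coprime (sym-coprime (1-coprimeTo (ℕ.suc n))))) eq

-- The curve y² = x³ + ax + b, with Δ = -16(4a³ + 27b²).
record EllipticCurve : Set where
  field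
    a b : ℚ
    Δ≢0 : - fromℕ 16 * (fromℕ 4 * (a * a * a) + fromℕ 27 * (b * b)) ≢ 0ℚ

module Points (E : EllipticCurve) where
  open EllipticCurve E

  OnCurve : ℚ → ℚ → Set
  OnCurve x y = y * y ≡ x * x * x + a * x + b

  -- The equation is irrelevant so that _≡_ on points is equality of
  -- coordinates; it can be recovered with recompute, since ℚ has
  -- decidable equality.
  data Point : Set where
    ∞      : Point
    affine : (x y : ℚ) → .(OnCurve x y) → Point

  -- (x₃ , y₃) with x₃ = thirdX s x₁ x₂ and y₃ = thirdY s x₁ y₁ x₃ is the
  -- reflection in the x-axis of the third intersection of the curve with
  -- the line of slope s through (x₁ , y₁) and (x₂ , y₂).
  thirdX : (s x₁ x₂ : ℚ) → ℚ
  thirdX s x₁ x₂ = s * s - x₁ - x₂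

  thirdY : (s x₁ y₁ x₃ : ℚ) → ℚ
  thirdY s x₁ y₁ x₃ = s * (x₁ - x₃) - y₁

  private
    f : ℚ → ℚ → ℚ
    f x y = y * y - (x * x * x + a * x + b)

    chord-identity : ∀ a b s x₁ y₁ x₂ →
      let g x y = y * y - (x * x * x + a * x + b)
          x₃ = thirdX s x₁ x₂
      in g x₃ (thirdY s x₁ y₁ x₃) * (x₂ - x₁) ≡
         g x₁ y₁ * (x₂ - x₃) + g x₂ (y₁ + s * (x₂ - x₁)) * (x₃ - x₁)
    chord-identity = solve 6 (λ a b s x₁ y₁ x₂ →
      let g x y = y :* y :- (x :* x :* x :+ a :* x :+ b)
          x₃ = s :* s :- x₁ :- x₂
      in g x₃ (s :* (x₁ :- x₃) :- y₁) :* (x₂ :- x₁) :=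
         g x₁ y₁ :* (x₂ :- x₃) :+ g x₂ (y₁ :+ s :* (x₂ :- x₁)) :* (x₃ :- x₁))
      refl

    tangent-identity : ∀ a b s x₁ y₁ →
      let g x y = y * y - (x * x * x + a * x + b)
          x₃ = thirdX s x₁ x₁
      in g x₃ (thirdY s x₁ y₁ x₃) ≡
         g x₁ y₁ + (s * (fromℕ 2 * y₁) - (fromℕ 3 * (x₁ * x₁) + a)) * (x₃ - x₁)
    tangent-identity = solve 5 (λ a b s x₁ y₁ →
      let g x y = y :* y :- (x :* x :* x :+ a :* x :+ b)
          x₃ = s :* s :- x₁ :- x₁
      in g x₃ (s :* (x₁ :- x₃) :- y₁) :=
         g x₁ y₁ :+ (s :* (con (fromℕ 2) :* y₁) :-
                     (con (fromℕ 3) :* (x₁ :* x₁) :+ a)) :* (x₃ :- x₁))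
      refl

    0*+0* : ∀ {u v} w z → u ≡ 0ℚ → v ≡ 0ℚ → u * w + v * z ≡ 0ℚ
    0*+0* w z refl refl = cong₂ _+_ (*-zeroˡ w) (*-zeroˡ z)

  private
    x₂-x₁-nonZero : ∀ x₁ x₂ → x₁ ≢ x₂ → NonZero (x₂ - x₁)
    x₂-x₁-nonZero x₁ x₂ x₁≢x₂ = ≢-nonZero λ eq → x₁≢x₂ (sym (-‿≡0 x₂ x₁ eq))

    y₁≢0 : ∀ x₁ y₁ x₂ y₂ → OnCurve x₁ y₁ → OnCurve x₂ y₂ →
           x₁ ≡ x₂ → y₁ ≢ - y₂ → y₁ ≢ 0ℚ
    y₁≢0 _ _ _ y₂ e₁ e₂ refl y₁≢-y₂ refl with y₂ ≟ 0ℚ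
    ... | yes refl = y₁≢-y₂ refl
    ... | no y₂≢0  = *-≢0 y₂≢0 y₂≢0 (trans e₂ (trans (sym e₁) (*-zeroˡ 0ℚ)))

    2y₁-nonZero : ∀ x₁ y₁ x₂ y₂ → .(OnCurve x₁ y₁) → .(OnCurve x₂ y₂) →
                  x₁ ≡ x₂ → y₁ ≢ - y₂ → NonZero (fromℕ 2 * y₁)
    2y₁-nonZero x₁ y₁ x₂ y₂ e₁ e₂ x₁≡x₂ y₁≢-y₂ =
      ≢-nonZero (*-≢0 {fromℕ 2} {y₁} (fromℕ≢0 2)
        (y₁≢0 x₁ y₁ x₂ y₂ (recompute (_ ≟ _) e₁) (recompute (_ ≟ _) e₂)
              x₁≡x₂ y₁≢-y₂))

    chord-onCurve : ∀ x₁ y₁ x₂ y₂ → OnCurve x₁ y₁ → OnCurve x₂ y₂ → x₁ ≢ x₂ →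
      .{{_ : NonZero (x₂ - x₁)}} →
      let s = (y₂ - y₁) ÷ (x₂ - x₁); x₃ = thirdX s x₁ x₂ in
      OnCurve x₃ (thirdY s x₁ y₁ x₃)
    chord-onCurve x₁ y₁ x₂ y₂ e₁ e₂ x₁≢x₂ = -‿≡0 _ _ (*-cancelʳ-0
      (λ eq → x₁≢x₂ (sym (-‿≡0 x₂ x₁ eq)))
      (trans (chord-identity a b s x₁ y₁ x₂)
        (0*+0* (x₂ - x₃) (x₃ - x₁) (≡⇒-‿≡0 e₁)
          (trans (cong (f x₂) onLine) (≡⇒-‿≡0 e₂)))))
      where
      s  = (y₂ - y₁) ÷ (x₂ - x₁)
      x₃ = thirdX s x₁ x₂
      onLine : y₁ + s * (x₂ - x₁) ≡ y₂
      onLine = trans (cong (y₁ +_) (÷-cancel (y₂ - y₁) (x₂ - x₁)))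
        (solve 2 (λ y₁ y₂ → y₁ :+ (y₂ :- y₁) := y₂) refl y₁ y₂)

    tangent-onCurve : ∀ x₁ y₁ → OnCurve x₁ y₁ → .{{_ : NonZero (fromℕ 2 * y₁)}} →
      let s = (fromℕ 3 * (x₁ * x₁) + a) ÷ (fromℕ 2 * y₁); x₃ = thirdX s x₁ x₁ in
      OnCurve x₃ (thirdY s x₁ y₁ x₃)
    tangent-onCurve x₁ y₁ e₁ = -‿≡0 _ _
      (trans (tangent-identity a b s x₁ y₁)
        (cong₂ _+_ (≡⇒-‿≡0 e₁)
          (trans (cong (_* (x₃ - x₁)) (≡⇒-‿≡0 (÷-cancel u v)))
                 (*-zeroˡ (x₃ - x₁)))))
      where
      u = fromℕ 3 * (x₁ * x₁) + a
      v = fromℕ 2 * y₁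
      s = u ÷ v
      x₃ = thirdX s x₁ x₁

  infixl 6 _⊕_
  infix  8 ⊖_

  _⊕_ : Point → Point → Point
  ∞ ⊕ Q = Q
  P@(affine _ _ _) ⊕ ∞ = P
  affine x₁ y₁ e₁ ⊕ affine x₂ y₂ e₂ with x₁ ≟ x₂
  ... | no x₁≢x₂ = affine x₃ (thirdY s x₁ y₁ x₃) (chord-onCurve x₁ y₁ x₂ y₂ e₁ e₂ x₁≢x₂)
    where
    instance _ = x₂-x₁-nonZero x₁ x₂ x₁≢x₂
    s  = (y₂ - y₁) ÷ (x₂ - x₁)
    x₃ = thirdX s x₁ x₂
  ... | yes x₁≡x₂ with y₁ ≟ - y₂
  ...   | yes _     = ∞
  ...   | no y₁≢-y₂ = affine x₃ (thirdY s x₁ y₁ x₃) (tangent-onCurve x₁ y₁ e₁)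
    where
    instance _ = 2y₁-nonZero x₁ y₁ x₂ y₂ e₁ e₂ x₁≡x₂ y₁≢-y₂
    s  = (fromℕ 3 * (x₁ * x₁) + a) ÷ (fromℕ 2 * y₁)
    x₃ = thirdX s x₁ x₁

  ⊖_ : Point → Point
  ⊖ ∞            = ∞
  ⊖ affine x y e = affine x (- y)
    (trans (solve 1 (λ y → (:- y) :* (:- y) := y :* y) refl y) e)

  rationalPoints : RawGroup 0ℓ 0ℓ
  rationalPoints = record
    { Carrier = Point
    ; _≈_     = _≡_
    ; _∙_     = _⊕_
    ; ε       = ∞
    ; _⁻¹     = ⊖_
    }

open Points public using (rationalPoints)

-- y² = x³ - 5pqx
E[_,_] : ∀ {p q} → Prime p → Prime q → EllipticCurve
E[_,_] {p} {q} p-prime q-prime = record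
  { a   = - D
  ; b   = 0ℚ
  ; Δ≢0 = λ Δ≡0 → *-≢0 64≢0 (*-≢0 (*-≢0 D≢0 D≢0) D≢0) (trans (sym Δ≡64D³) Δ≡0)
  }
  where
  instance
    _ = prime⇒nonZero p-prime
    _ = prime⇒nonZero q-prime
    _ = ℕ.m*n≢0 5 p
    _ = ℕ.m*n≢0 (5 ℕ.* p) q

  D : ℚ
  D = fromℕ (5 ℕ.* p ℕ.* q)

  D≢0 : D ≢ 0ℚ
  D≢0 = fromℕ≢0 (5 ℕ.* p ℕ.* q)

  64≢0 : fromℕ 64 ≢ 0ℚ
  64≢0 = fromℕ≢0 64

  Δ≡64D³ : - fromℕ 16 * (fromℕ 4 * (- D * - D * - D) + fromℕ 27 * (0ℚ * 0ℚ))
           ≡ fromℕ 64 * (D * D * D)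
  Δ≡64D³ = solve 1 (λ D →
    con (- fromℕ 16) :* (con (fromℕ 4) :* (:- D :* :- D :* :- D)
                         :+ con (fromℕ 27) :* (con 0ℚ :* con 0ℚ))
    := con (fromℕ 64) :* (D :* D :* D)) refl D

-- The library's RawGroup of parities under addition does not have the
-- additive inverse (its _⁻¹ swaps 0ℙ and 1ℙ), so the raw group is taken
-- from the Group bundle.
ℤ/2ℤ : RawGroup 0ℓ 0ℓ
ℤ/2ℤ = Group.rawGroup Parity.+-0-group

{-# OPTIONS --safe #-}

-- Put a = -5pq, so that a ≡ 1 mod 4; nothing else about a matters. Over Z₍₂₎ no
-- rational point has odd abscissa, so every point reduces to ∞ or to T = (0, 0)
-- modulo 2. Let z be the abscissa of P or of P + T, whichever reduces to T,
-- and 0 at ∞. For P other than ∞ and T, the ratio z(nP) / z(P) lies in Z₍₂₎ and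
-- is congruent to n modulo 2, because it satisfies a quadratic equation over
-- Z₍₂₎ coming from collinearity. If nP ∈ {∞ , T}, this ratio is zero, so n is
-- even and nP reduces to ∞; thus nP is never T, and nP = ∞ forces n = 2m. Then
-- mP = -mP is ∞ or T, hence ∞, and one descends. Of the group law only -P + (P + Q) = Q
-- and -(P + Q) = -P + -Q are needed, not associativity.
module Submission where

open import Defs
open import Algebra.Bundles using (RawGroup)
import Algebra.Definitions.RawMonoid as RawMonoidDefinitions
open import Data.Empty using (⊥; ⊥-elim)
open import Data.Integer.Base as ℤ using (ℤ; +_; -[1+_])
import Data.Integer.Properties as ℤ
open import Data.Nat.Base as ℕ using (ℕ; zero; suc; parity; _%_)
open import Data.Nat.Coprimality as Coprime using (Coprime; 1-coprimeTo)
open import Data.Nat.DivMod using (m≡m%n+[m/n]*n)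
open import Data.Nat.Divisibility using (_∣_; divides)
open import Data.Nat.Induction using (<-rec)
open import Data.Nat.Primality using (Prime)
import Data.Nat.Properties as ℕ
import Data.Nat.Solver as ℕ
open import Data.Parity.Base as ℙ using (Parity; 0ℙ; 1ℙ)
import Data.Parity.Properties as ℙ
open import Data.Product.Base using (Σ-syntax; ∃-syntax; _×_; _,_)
open import Data.Rational.Base
  using (ℚ; mkℚ; 0ℚ; 1ℚ; ½; _+_; _*_; _-_; -_; _÷_; 1/_; NonZero; ≢-nonZero; fromℚᵘ; ↥_; ↧_)
open import Data.Rational.Properties
open import Data.Rational.Solver using (module +-*-Solver)
open import Data.Rational.Unnormalised.Base using (mkℚᵘ; *≡*)
open import Data.Sum.Base using (_⊎_; inj₁; inj₂; [_,_]′)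
open import Relation.Binary.PropositionalEquality
open import Relation.Nullary using (¬_; Dec; yes; no; recompute; contradiction)

open import Algebra.Properties.Group +-0-group
  using (⁻¹-involutive)
  renaming (∙-cancelˡ to +-cancelˡ; x∙y⁻¹≈ε⇒x≈y to x-y≡0⇒x≡y; x≈y⇒x∙y⁻¹≈ε to x≡y⇒x-y≡0)

open +-*-Solver using (solve; _:=_; _:+_; _:*_; _:-_; :-_; con)

-- The group law

-- Modulo 2 the curve is `y² = x (x + 1)²`, with a cusp at `(1 , 0)`. Excluding odd abscissas
-- therefore says that every rational point has smooth reduction; the smooth points modulo 2 form a
-- group of order two, which the parities attached to points record. If three points add up to `∞`,
-- then one or three of them reduce to `∞`. So an odd number of them are translated by `T`, and the
-- three coordinates z are abscissas of points adding up to `T`: one symmetric relation serves all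
-- the cases. An abscissa does not distinguish a point from its opposite, so z behaves like the
-- square of an additive parameter, and the ratio z(nP) / z(P) resembles n², which is n modulo 2.
-- For the same reason the relation cannot tell P + nP from -P + nP, and only a quadratic equation
-- results. But (n + 1)² and (n - 1)² have the same parity, so the residue is determined although
-- the root is not.

+-≡0 : ∀ {u v} → u ≡ 0ℚ → v ≡ 0ℚ → u + v ≡ 0ℚ
+-≡0 refl refl = refl

*-≡0 : ∀ k {u} → u ≡ 0ℚ → k * u ≡ 0ℚ
*-≡0 k refl = *-zeroʳ k

*-diff≡0 : ∀ k {u v} → u ≡ v → k * (u - v) ≡ 0ℚ
*-diff≡0 k {u} refl = trans (cong (k *_) (+-inverseʳ u)) (*-zeroʳ k)

-- Equations are deduced from others by exhibiting the difference of the two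
-- sides as a combination of the differences in the hypotheses.
≡-from : ∀ {u v w} → u - v ≡ w → w ≡ 0ℚ → u ≡ v
≡-from eq w≡0 = x-y≡0⇒x≡y _ _ (trans eq w≡0)

*≡0⇒≡0∨≡0 : ∀ u v → u * v ≡ 0ℚ → u ≡ 0ℚ ⊎ v ≡ 0ℚ
*≡0⇒≡0∨≡0 u v uv≡0 with u ≟ 0ℚ
... | yes u≡0 = inj₁ u≡0
... | no u≢0  = inj₂ (*-cancelˡ-≡0)
  where
  instance _ = ≢-nonZero u≢0
  open ≡-Reasoning
  *-cancelˡ-≡0 : v ≡ 0ℚ
  *-cancelˡ-≡0 = begin
    v               ≡⟨ *-identityˡ v ⟨
    1ℚ * v          ≡⟨ cong (_* v) (*-inverseˡ u) ⟨
    1/ u * u * v    ≡⟨ *-assoc (1/ u) u v ⟩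
    1/ u * (u * v)  ≡⟨ cong (1/ u *_) uv≡0 ⟩
    1/ u * 0ℚ       ≡⟨ *-zeroʳ (1/ u) ⟩
    0ℚ              ∎

*-cancelˡ-≡0 : ∀ {u v} → u ≢ 0ℚ → u * v ≡ 0ℚ → v ≡ 0ℚ
*-cancelˡ-≡0 {u} {v} u≢0 uv≡0 with *≡0⇒≡0∨≡0 u v uv≡0
... | inj₁ u≡0 = contradiction u≡0 u≢0
... | inj₂ v≡0 = v≡0

x²≡0⇒x≡0 : ∀ x → x * x ≡ 0ℚ → x ≡ 0ℚ
x²≡0⇒x≡0 x eq with *≡0⇒≡0∨≡0 x x eq
... | inj₁ x≡0 = x≡0
... | inj₂ x≡0 = x≡0

÷-* : ∀ u v .{{_ : NonZero v}} → (u ÷ v) * v ≡ u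
÷-* u v = begin
  u * 1/ v * v    ≡⟨ *-assoc u (1/ v) v ⟩
  u * (1/ v * v)  ≡⟨ cong (u *_) (*-inverseˡ v) ⟩
  u * 1ℚ          ≡⟨ *-identityʳ u ⟩
  u               ∎
  where open ≡-Reasoning

2y≡0⇒y≡0 : ∀ y → fromℕ 2 * y ≡ 0ℚ → y ≡ 0ℚ
2y≡0⇒y≡0 y = *-cancelˡ-≡0 {fromℕ 2} (λ ())

y≡-y⇒y≡0 : ∀ y → y ≡ - y → y ≡ 0ℚ
y≡-y⇒y≡0 y eq = 2y≡0⇒y≡0 y (trans
  (solve 1 (λ y → con (fromℕ 2) :* y := y :- (:- y)) refl y) (x≡y⇒x-y≡0 eq))

-- Lines meeting a Weierstrass cubic

module GroupLaw (E : EllipticCurve) where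
  open EllipticCurve E
  open Points E hiding (rationalPoints)

  -- x³ + ax + b - (sx + c)² = (x - x₁)(x - x₂)(x - x₃), by coefficients.
  record Line (s c x₁ x₂ x₃ : ℚ) : Set where
    field
      e₁≡ : x₁ + x₂ + x₃ ≡ s * s
      e₂≡ : x₁ * x₂ + x₁ * x₃ + x₂ * x₃ + fromℕ 2 * (s * c) ≡ a
      e₃≡ : x₁ * x₂ * x₃ + b ≡ c * c

  line-swap : ∀ {s c x₁ x₂ x₃} → Line s c x₁ x₂ x₃ → Line s c x₁ x₃ x₂
  line-swap {s} {c} {x₁} {x₂} {x₃} L = record
    { e₁≡ = trans (solve 3 (λ x y z → x :+ y :+ z := x :+ z :+ y) refl x₁ x₃ x₂) e₁≡
    ; e₂≡ = trans (solve 4 (λ x y z w → x :* y :+ x :* z :+ y :* z :+ w :=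
                                        x :* z :+ x :* y :+ z :* y :+ w)
                     refl x₁ x₃ x₂ (fromℕ 2 * (s * c))) e₂≡
    ; e₃≡ = trans (solve 4 (λ x y z w → x :* y :* z :+ w := x :* z :* y :+ w)
                     refl x₁ x₃ x₂ b) e₃≡
    }
    where open Line L

  line-neg : ∀ {s c x₁ x₂ x₃} → Line s c x₁ x₂ x₃ → Line (- s) (- c) x₁ x₂ x₃
  line-neg {s} {c} {x₁} {x₂} {x₃} L = record
    { e₁≡ = trans e₁≡ (-x*-x s)
    ; e₂≡ = trans (cong (λ t → x₁ * x₂ + x₁ * x₃ + x₂ * x₃ + fromℕ 2 * t)
                    (solve 2 (λ s c → (:- s) :* (:- c) := s :* c) refl s c)) e₂≡
    ; e₃≡ = trans e₃≡ (-x*-x c)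
    }
    where
    open Line L
    -x*-x : ∀ x → x * x ≡ (- x) * (- x)
    -x*-x = solve 1 (λ x → x :* x := (:- x) :* (:- x)) refl

  -- A double root of `x³ + ax + b - (sx + c)²` is also a root of its derivative.
  line-tangent : ∀ {s c x x₃} → Line s c x x x₃ →
                 fromℕ 3 * (x * x) + a ≡ s * (fromℕ 2 * (s * x + c))
  line-tangent {s} {c} {x} {x₃} L = ≡-from
    (solve 5 (λ s c x x₃ a →
      (con (fromℕ 3) :* (x :* x) :+ a) :- s :* (con (fromℕ 2) :* (s :* x :+ c)) :=
      con (- fromℕ 1) :* (x :* x :+ x :* x₃ :+ x :* x₃ :+ con (fromℕ 2) :* (s :* c) :- a)
      :+ (con (fromℕ 2) :* x) :* (x :+ x :+ x₃ :- s :* s)) refl s c x x₃ a)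
    (+-≡0 (*-diff≡0 (- fromℕ 1) e₂≡) (*-diff≡0 (fromℕ 2 * x) e₁≡))
    where open Line L

  -- The last hypothesis is the vanishing of the divided difference of `x³ + ax + b - (sx + c)²` at
  -- `x₁` and `x₂`. At equal arguments it becomes the derivative, so chords and tangents share this
  -- lemma.
  mkLine : ∀ s c x₁ x₂ y₁ → OnCurve x₁ y₁ → y₁ ≡ s * x₁ + c →
           x₁ * x₁ + x₁ * x₂ + x₂ * x₂ + a ≡ s * s * (x₁ + x₂) + fromℕ 2 * (s * c) →
           Line s c x₁ x₂ (thirdX s x₁ x₂)
  mkLine s c x₁ x₂ y₁ e₁ refl k = record
    { e₁≡ = solve 3 (λ s x₁ x₂ → x₁ :+ x₂ :+ (s :* s :- x₁ :- x₂) := s :* s) refl s x₁ x₂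
    ; e₂≡ = ≡-from
        (solve 5 (λ s c x₁ x₂ a → let x₃ = s :* s :- x₁ :- x₂ in
          x₁ :* x₂ :+ x₁ :* x₃ :+ x₂ :* x₃ :+ con (fromℕ 2) :* (s :* c) :- a :=
          con (- fromℕ 1) :* (x₁ :* x₁ :+ x₁ :* x₂ :+ x₂ :* x₂ :+ a
            :- (s :* s :* (x₁ :+ x₂) :+ con (fromℕ 2) :* (s :* c))))
          refl s c x₁ x₂ a)
        (*-diff≡0 (- fromℕ 1) k)
    ; e₃≡ = ≡-from
        (solve 6 (λ s c x₁ x₂ a b → let x₃ = s :* s :- x₁ :- x₂; y₁ = s :* x₁ :+ c in
          x₁ :* x₂ :* x₃ :+ b :- c :* c :=
          con (- fromℕ 1) :* (y₁ :* y₁ :- (x₁ :* x₁ :* x₁ :+ a :* x₁ :+ b))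
          :+ (:- x₁) :* (x₁ :* x₁ :+ x₁ :* x₂ :+ x₂ :* x₂ :+ a
            :- (s :* s :* (x₁ :+ x₂) :+ con (fromℕ 2) :* (s :* c))))
          refl s c x₁ x₂ a b)
        (+-≡0 (*-diff≡0 (- fromℕ 1) e₁) (*-diff≡0 (- x₁) k))
    }

  y≡sx+[y-sx] : ∀ s x y → y ≡ s * x + (y - s * x)
  y≡sx+[y-sx] = solve 3 (λ s x y → y := s :* x :+ (y :- s :* x)) refl

  thirdY≡ : ∀ s x₁ y₁ x₃ → thirdY s x₁ y₁ x₃ ≡ - (s * x₃ + (y₁ - s * x₁))
  thirdY≡ = solve 4 (λ s x₁ y₁ x₃ →
    s :* (x₁ :- x₃) :- y₁ := :- (s :* x₃ :+ (y₁ :- s :* x₁))) refl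

  chord-through : ∀ s x₁ y₁ x₂ y₂ → s * (x₂ - x₁) ≡ y₂ - y₁ → y₂ ≡ s * x₂ + (y₁ - s * x₁)
  chord-through s x₁ y₁ x₂ y₂ slope = ≡-from
    (solve 5 (λ s x₁ y₁ x₂ y₂ → y₂ :- (s :* x₂ :+ (y₁ :- s :* x₁)) :=
      con (- fromℕ 1) :* (s :* (x₂ :- x₁) :- (y₂ :- y₁))) refl s x₁ y₁ x₂ y₂)
    (*-diff≡0 (- fromℕ 1) slope)

  chord-line : ∀ s c x₁ y₁ x₂ y₂ → OnCurve x₁ y₁ → OnCurve x₂ y₂ → x₂ - x₁ ≢ 0ℚ →
               y₁ ≡ s * x₁ + c → y₂ ≡ s * x₂ + c → Line s c x₁ x₂ (thirdX s x₁ x₂)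
  chord-line s c x₁ y₁ x₂ y₂ e₁ e₂ d≢0 refl refl = mkLine s c x₁ x₂ y₁ e₁ refl
    (x-y≡0⇒x≡y _ _ (*-cancelˡ-≡0 d≢0 (trans
      (solve 6 (λ s c x₁ x₂ a b → let y₁ = s :* x₁ :+ c; y₂ = s :* x₂ :+ c in
        (x₂ :- x₁) :* (x₁ :* x₁ :+ x₁ :* x₂ :+ x₂ :* x₂ :+ a
          :- (s :* s :* (x₁ :+ x₂) :+ con (fromℕ 2) :* (s :* c)))
        := con (fromℕ 1) :* (y₁ :* y₁ :- (x₁ :* x₁ :* x₁ :+ a :* x₁ :+ b))
           :+ con (- fromℕ 1) :* (y₂ :* y₂ :- (x₂ :* x₂ :* x₂ :+ a :* x₂ :+ b)))
        refl s c x₁ x₂ a b)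
      (+-≡0 (*-diff≡0 (fromℕ 1) e₁) (*-diff≡0 (- fromℕ 1) e₂)))))

  tangent-line : ∀ s x y → OnCurve x y → s * (fromℕ 2 * y) ≡ fromℕ 3 * (x * x) + a →
                 Line s (y - s * x) x x (thirdX s x x)
  tangent-line s x y e slope = mkLine s (y - s * x) x x y e (y≡sx+[y-sx] s x y) (≡-from
    (solve 4 (λ s x y a →
      (x :* x :+ x :* x :+ x :* x :+ a)
        :- (s :* s :* (x :+ x) :+ con (fromℕ 2) :* (s :* (y :- s :* x)))
      := con (- fromℕ 1) :* (s :* (con (fromℕ 2) :* y) :- (con (fromℕ 3) :* (x :* x) :+ a)))
      refl s x y a)
    (*-diff≡0 (- fromℕ 1) slope))

  -- Addition described by lines

  opposite-or-equal : ∀ x y₁ y₂ → OnCurve x y₁ → OnCurve x y₂ → y₁ ≢ - y₂ → y₁ ≡ y₂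
  opposite-or-equal x y₁ y₂ e₁ e₂ y₁≢-y₂ =
    [ x-y≡0⇒x≡y y₁ y₂ , (λ eq → contradiction (x-y≡0⇒x≡y y₁ (- y₂) eq) y₁≢-y₂) ]′
    (*≡0⇒≡0∨≡0 (y₁ - y₂) (y₁ - - y₂) (trans
      (solve 2 (λ y z → (y :- z) :* (y :- (:- z)) := y :* y :- z :* z) refl y₁ y₂)
      (x≡y⇒x-y≡0 (trans e₁ (sym e₂)))))

  -- Chord and tangent merge into `secant`: what is used afterwards is the line and the
  -- factorisation of the cubic along it, not the formula for the slope.
  data Sum (x₁ y₁ x₂ y₂ : ℚ) : Point → Set where
    opposite : x₁ ≡ x₂ → y₁ ≡ - y₂ → Sum x₁ y₁ x₂ y₂ ∞
    secant   : ∀ {x₃ y₃} .{e : OnCurve x₃ y₃} s c →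
               y₁ ≡ s * x₁ + c → y₂ ≡ s * x₂ + c → y₃ ≡ - (s * x₃ + c) →
               Line s c x₁ x₂ x₃ → Sum x₁ y₁ x₂ y₂ (affine x₃ y₃ e)

  ⊕-sum : ∀ x₁ y₁ x₂ y₂ .(e₁ : OnCurve x₁ y₁) .(e₂ : OnCurve x₂ y₂) →
          Sum x₁ y₁ x₂ y₂ (affine x₁ y₁ e₁ ⊕ affine x₂ y₂ e₂)
  ⊕-sum x₁ y₁ x₂ y₂ e₁ e₂ with x₁ ≟ x₂
  ... | no x₁≢x₂ = secant s (y₁ - s * x₁) (y≡sx+[y-sx] s x₁ y₁) y₂≡
      (thirdY≡ s x₁ y₁ (thirdX s x₁ x₂))
      (chord-line s (y₁ - s * x₁) x₁ y₁ x₂ y₂ (recompute (_ ≟ _) e₁) (recompute (_ ≟ _) e₂)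
        d≢0 (y≡sx+[y-sx] s x₁ y₁) y₂≡)
    where
    d≢0 : x₂ - x₁ ≢ 0ℚ
    d≢0 eq = x₁≢x₂ (sym (x-y≡0⇒x≡y x₂ x₁ eq))
    instance _ = ≢-nonZero d≢0
    s = (y₂ - y₁) ÷ (x₂ - x₁)
    y₂≡ : y₂ ≡ s * x₂ + (y₁ - s * x₁)
    y₂≡ = chord-through s x₁ y₁ x₂ y₂ (÷-* (y₂ - y₁) (x₂ - x₁))
  ... | yes refl with y₁ ≟ - y₂
  ...   | yes y₁≡-y₂ = opposite refl y₁≡-y₂
  ...   | no y₁≢-y₂ = secant s (y₁ - s * x₁) (y≡sx+[y-sx] s x₁ y₁)
      (trans (sym y₁≡y₂) (y≡sx+[y-sx] s x₁ y₁))
      (thirdY≡ s x₁ y₁ (thirdX s x₁ x₁))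
      (tangent-line s x₁ y₁ (recompute (_ ≟ _) e₁)
        (÷-* (fromℕ 3 * (x₁ * x₁) + a) (fromℕ 2 * y₁)))
    where
    y₁≡y₂ : y₁ ≡ y₂
    y₁≡y₂ = opposite-or-equal x₁ y₁ y₂ (recompute (_ ≟ _) e₁) (recompute (_ ≟ _) e₂) y₁≢-y₂
    2y₁≢0 : fromℕ 2 * y₁ ≢ 0ℚ
    2y₁≢0 eq = y₁≢-y₂ (trans y₁≡0 (cong -_ (trans (sym y₁≡0) y₁≡y₂)))
      where
      y₁≡0 : y₁ ≡ 0ℚ
      y₁≡0 = 2y≡0⇒y≡0 y₁ eq
    instance _ = ≢-nonZero 2y₁≢0
    s = (fromℕ 3 * (x₁ * x₁) + a) ÷ (fromℕ 2 * y₁)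

  -- Uniqueness of the secant

  nonsingular : ∀ x → x * x * x + a * x + b ≡ 0ℚ → fromℕ 3 * (x * x) + a ≢ 0ℚ
  nonsingular x f≡0 f′≡0 = Δ≢0 (*-≡0 (- fromℕ 16) (trans
    -- A Bézout identity: `4a³ + 27b²` lies in the ideal generated by the cubic and its derivative.
    (solve 3 (λ a b x →
      con (fromℕ 4) :* (a :* a :* a) :+ con (fromℕ 27) :* (b :* b) :=
      (con (fromℕ 27) :* (b :- (x :* x :* x :+ a :* x))) :* (x :* x :* x :+ a :* x :+ b)
      :+ (con (fromℕ 4) :* (a :* a) :+ con (fromℕ 15) :* (a :* (x :* x))
            :+ con (fromℕ 9) :* (x :* x :* (x :* x))) :* (con (fromℕ 3) :* (x :* x) :+ a))
      refl a b x)
    (+-≡0 (*-≡0 (fromℕ 27 * (b - (x * x * x + a * x))) f≡0)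
      (*-≡0 (fromℕ 4 * (a * a) + fromℕ 15 * (a * (x * x)) + fromℕ 9 * (x * x * (x * x)))
        f′≡0))))

  -- By `line-tangent`, a double intersection at height zero would make the derivative of the cubic
  -- vanish as well: at a point of order two the tangent is vertical.
  line-y≢0 : ∀ {s c x x₃} → Line s c x x x₃ → OnCurve x (s * x + c) → s * x + c ≢ 0ℚ
  line-y≢0 {s} {c} {x} L e y≡0 = nonsingular x
    (trans (sym e) (trans (cong (_* (s * x + c)) y≡0) (*-zeroˡ (s * x + c))))
    (trans (line-tangent L)
      (trans (cong (λ y → s * (fromℕ 2 * y)) y≡0) (*-zeroʳ s)))

  -- Distinct abscissas determine the slope by subtraction; equal ones determine it through the
  -- derivative, since the ordinate is nonzero there.
  slope-unique : ∀ {s c s′ c′ x₁ x₂ x₃ x₃′} →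
    OnCurve x₁ (s * x₁ + c) → Line s c x₁ x₂ x₃ → Line s′ c′ x₁ x₂ x₃′ →
    s * x₁ + c ≡ s′ * x₁ + c′ → s * x₂ + c ≡ s′ * x₂ + c′ → s ≡ s′
  slope-unique {s} {c} {s′} {c′} {x₁} {x₂} e L L′ y₁≡ y₂≡ with x₁ ≟ x₂
  ... | no x₁≢x₂ = x-y≡0⇒x≡y s s′ (*-cancelˡ-≡0 {x₁ - x₂} {s - s′}
    (λ eq → x₁≢x₂ (x-y≡0⇒x≡y x₁ x₂ eq)) (trans
    (solve 6 (λ s c s′ c′ x₁ x₂ → (x₁ :- x₂) :* (s :- s′) :=
      con (fromℕ 1) :* ((s :* x₁ :+ c) :- (s′ :* x₁ :+ c′))
      :+ con (- fromℕ 1) :* ((s :* x₂ :+ c) :- (s′ :* x₂ :+ c′))) refl s c s′ c′ x₁ x₂)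
    (+-≡0 (*-diff≡0 (fromℕ 1) y₁≡) (*-diff≡0 (- fromℕ 1) y₂≡))))
  ... | yes refl = x-y≡0⇒x≡y s s′ (*-cancelˡ-≡0 {fromℕ 2 * (s * x₁ + c)} {s - s′}
    (λ eq → line-y≢0 L e (2y≡0⇒y≡0 _ eq)) (trans
    (solve 3 (λ s s′ y → con (fromℕ 2) :* y :* (s :- s′) :=
      s :* (con (fromℕ 2) :* y) :- s′ :* (con (fromℕ 2) :* y)) refl s s′ (s * x₁ + c))
    (x≡y⇒x-y≡0 (trans (sym (line-tangent L)) (trans (line-tangent L′)
      (cong (λ y → s′ * (fromℕ 2 * y)) (sym y₁≡)))))))

  affine-cong : ∀ {x y x′ y′} .{e : OnCurve x y} .{e′ : OnCurve x′ y′} →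
                x ≡ x′ → y ≡ y′ → affine x y e ≡ affine x′ y′ e′
  affine-cong refl refl = refl

  -- Computes a sum from any line exhibited, without unfolding the case split of `⊕`: the slope and
  -- the intercept supplied by `⊕-sum` agree with the given ones, hence so do the third abscissas.
  line-⊕ : ∀ {s c x₁ y₁ x₂ y₂ x₃ y₃} →
    .(e₁ : OnCurve x₁ y₁) .(e₂ : OnCurve x₂ y₂) .(e₃ : OnCurve x₃ y₃) →
    y₁ ≡ s * x₁ + c → y₂ ≡ s * x₂ + c → y₃ ≡ - (s * x₃ + c) → Line s c x₁ x₂ x₃ →
    affine x₁ y₁ e₁ ⊕ affine x₂ y₂ e₂ ≡ affine x₃ y₃ e₃
  line-⊕ {s} {c} {x₁} {y₁} {x₂} {y₂} {x₃} {y₃} e₁ e₂ e₃ y₁≡ y₂≡ y₃≡ L =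
    from-sum (⊕-sum x₁ y₁ x₂ y₂ e₁ e₂)
    where
    e : OnCurve x₁ (s * x₁ + c)
    e = subst (OnCurve x₁) y₁≡ (recompute (_ ≟ _) e₁)
    from-sum : ∀ {R} → Sum x₁ y₁ x₂ y₂ R → R ≡ affine x₃ y₃ e₃
    -- Both ordinates lie on one nonvertical line over the same abscissa, so they are equal as well
    -- as opposite.
    from-sum (opposite refl y₁≡-y₂) = contradiction
      (y≡-y⇒y≡0 (s * x₁ + c) (trans (sym y₁≡) (trans y₁≡-y₂ (cong -_ y₂≡)))) (line-y≢0 L e)
    from-sum (secant {x₃′} s′ c′ y₁≡′ y₂≡′ y₃≡′ L′) = affine-cong x₃′≡x₃
      (trans y₃≡′ (trans (cong -_ (cong₂ _+_ (cong₂ _*_ (sym s≡s′) x₃′≡x₃) (sym c≡c′)))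
        (sym y₃≡)))
      where
      s≡s′ : s ≡ s′
      s≡s′ = slope-unique e L L′ (trans (sym y₁≡) y₁≡′) (trans (sym y₂≡) y₂≡′)
      c≡c′ : c ≡ c′
      c≡c′ = +-cancelˡ (s * x₁) c c′
        (trans (sym y₁≡) (trans y₁≡′ (cong (λ s → s * x₁ + c′) (sym s≡s′))))
      x₃′≡x₃ : x₃′ ≡ x₃
      x₃′≡x₃ = +-cancelˡ (x₁ + x₂) x₃′ x₃
        (trans (Line.e₁≡ L′) (trans (cong (λ s → s * s) (sym s≡s′)) (sym (Line.e₁≡ L))))

  opposite-⊕ : ∀ x₁ y₁ x₂ y₂ .{e₁ : OnCurve x₁ y₁} .{e₂ : OnCurve x₂ y₂} →
    x₁ ≡ x₂ → y₁ ≡ - y₂ → affine x₁ y₁ e₁ ⊕ affine x₂ y₂ e₂ ≡ ∞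
  opposite-⊕ x₁ y₁ x₂ y₂ x₁≡x₂ y₁≡-y₂ with x₁ ≟ x₂
  ... | no x₁≢x₂ = contradiction x₁≡x₂ x₁≢x₂
  ... | yes _ with y₁ ≟ - y₂
  ...   | yes _ = refl
  ...   | no y₁≢-y₂ = contradiction y₁≡-y₂ y₁≢-y₂

  -- Group identities read off from lines

  ⊕-identityʳ : ∀ P → P ⊕ ∞ ≡ P
  ⊕-identityʳ ∞              = refl
  ⊕-identityʳ (affine _ _ _) = refl

  ⊕-inverseˡ : ∀ P → ⊖ P ⊕ P ≡ ∞
  ⊕-inverseˡ ∞              = refl
  ⊕-inverseˡ (affine x y e) = opposite-⊕ x (- y) x y refl refl

  -[sx+c] : ∀ s x c → - (s * x + c) ≡ - s * x + - c
  -[sx+c] = solve 3 (λ s x c → :- (s :* x :+ c) := (:- s) :* x :+ (:- c)) refl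

  -- Since `P`, `Q` and `⊖ (P ⊕ Q)` are collinear, so are their reflections `⊖ P`, `⊖ Q` and
  -- `P ⊕ Q`; exchanging the last two gives the sum of `⊖ P` and `P ⊕ Q`.
  ⊖-⊕-cancel : ∀ P Q → ⊖ P ⊕ (P ⊕ Q) ≡ Q
  ⊖-⊕-cancel ∞ Q = refl
  ⊖-⊕-cancel P@(affine _ _ _) ∞ = ⊕-inverseˡ P
  ⊖-⊕-cancel (affine x₁ y₁ e₁) (affine x₂ y₂ e₂) = from-sum (⊕-sum x₁ y₁ x₂ y₂ e₁ e₂)
    where
    from-sum : ∀ {R} → Sum x₁ y₁ x₂ y₂ R → ⊖ affine x₁ y₁ e₁ ⊕ R ≡ affine x₂ y₂ e₂
    from-sum (opposite x₁≡x₂ y₁≡-y₂) =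
      affine-cong x₁≡x₂ (trans (cong -_ y₁≡-y₂) (⁻¹-involutive y₂))
    from-sum (secant {x₃} {e = e₃} s c y₁≡ y₂≡ y₃≡ L) =
      line-⊕ _ e₃ e₂ (trans (cong -_ y₁≡) (-[sx+c] s x₁ c)) (trans y₃≡ (-[sx+c] s x₃ c))
        (trans y₂≡ (trans (sym (⁻¹-involutive _)) (cong -_ (-[sx+c] s x₂ c))))
        (line-swap (line-neg L))

  ⊖-⊕-distrib : ∀ P Q → ⊖ (P ⊕ Q) ≡ ⊖ P ⊕ ⊖ Q
  ⊖-⊕-distrib ∞ Q = refl
  ⊖-⊕-distrib (affine _ _ _) ∞ = refl
  ⊖-⊕-distrib (affine x₁ y₁ e₁) (affine x₂ y₂ e₂) = from-sum (⊕-sum x₁ y₁ x₂ y₂ e₁ e₂)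
    where
    from-sum : ∀ {R} → Sum x₁ y₁ x₂ y₂ R → ⊖ R ≡ ⊖ affine x₁ y₁ e₁ ⊕ ⊖ affine x₂ y₂ e₂
    from-sum (opposite x₁≡x₂ y₁≡-y₂) = sym (opposite-⊕ x₁ (- y₁) x₂ (- y₂) x₁≡x₂ (cong -_ y₁≡-y₂))
    from-sum (secant {x₃} s c y₁≡ y₂≡ y₃≡ L) =
      sym (line-⊕ _ _ _ (trans (cong -_ y₁≡) (-[sx+c] s x₁ c))
        (trans (cong -_ y₂≡) (-[sx+c] s x₂ c))
        (cong -_ (trans y₃≡ (-[sx+c] s x₃ c))) (line-neg L))

  open RawMonoidDefinitions (RawGroup.rawMonoid (rationalPoints E)) public
    using () renaming (_×_ to _·_)

  -- Each step of the induction moves one copy of `P` to the other side by cancelling it on the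
  -- left, so multiples are never regrouped.
  ·-opposite : ∀ j k P → (j ℕ.+ k) · P ≡ ∞ → j · P ≡ ⊖ (k · P)
  ·-opposite j zero P eq = subst (λ n → n · P ≡ ∞) (ℕ.+-identityʳ j) eq
  ·-opposite j (suc k) P eq = begin
    j · P                    ≡⟨ ⊖-⊕-cancel P (j · P) ⟨
    ⊖ P ⊕ suc j · P          ≡⟨ cong (⊖ P ⊕_) (·-opposite (suc j) k P
                                  (subst (λ n → n · P ≡ ∞) (ℕ.+-suc j k) eq)) ⟩
    ⊖ P ⊕ ⊖ (k · P)          ≡⟨ ⊖-⊕-distrib P (k · P) ⟨
    ⊖ (suc k · P)            ∎
    where open ≡-Reasoning

-- The local ring at 2

-- Built directly in lowest terms, so that `↥_` computes on it even for a variable integer.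
ι : ℤ → ℚ
ι i = mkℚ i 0 (Coprime.sym (1-coprimeTo ℤ.∣ i ∣))

/1≡ι : ∀ i → fromℚᵘ (mkℚᵘ i 0) ≡ ι i
/1≡ι i = fromℚᵘ-toℚᵘ (ι i)

ι-+ : ∀ i j → ι i + ι j ≡ ι (i ℤ.+ j)
ι-+ i j = trans
  (fromℚᵘ-cong {mkℚᵘ (i ℤ.* + 1 ℤ.+ j ℤ.* + 1) 0} {mkℚᵘ (i ℤ.+ j) 0}
    (*≡* (cong (ℤ._* + 1) (cong₂ ℤ._+_ (ℤ.*-identityʳ i) (ℤ.*-identityʳ j)))))
  (/1≡ι (i ℤ.+ j))

ι-* : ∀ i j → ι i * ι j ≡ ι (i ℤ.* j)
ι-* i j = /1≡ι (i ℤ.* j)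

ι-neg : ∀ i → - ι i ≡ ι (ℤ.- i)
ι-neg (+ zero)   = refl
ι-neg (+ suc _)  = refl
ι-neg -[1+ _ ]   = refl

ι-injective : ∀ {i j} → ι i ≡ ι j → i ≡ j
ι-injective = cong ↥_

*↧≡↥ : ∀ x → x * ι (↧ x) ≡ ι (↥ x)
*↧≡↥ x@(mkℚ n d _) = trans
  (fromℚᵘ-cong {mkℚᵘ (n ℤ.* + suc d) (d ℕ.* 1)} {mkℚᵘ n 0} (*≡* (begin
    n ℤ.* + suc d ℤ.* + 1      ≡⟨ ℤ.*-identityʳ _ ⟩
    n ℤ.* + suc d              ≡⟨ cong (λ k → n ℤ.* + k) (ℕ.*-identityʳ (suc d)) ⟨
    n ℤ.* + (suc d ℕ.* 1)      ∎)))
  (/1≡ι n)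
  where open ≡-Reasoning

data Integer : ℚ → Set where
  ι-integer : ∀ i → Integer (ι i)

integer-+ : ∀ {x y} → Integer x → Integer y → Integer (x + y)
integer-+ (ι-integer i) (ι-integer j) = subst Integer (sym (ι-+ i j)) (ι-integer (i ℤ.+ j))

integer-* : ∀ {x y} → Integer x → Integer y → Integer (x * y)
integer-* (ι-integer i) (ι-integer j) = subst Integer (sym (ι-* i j)) (ι-integer (i ℤ.* j))

integer-neg : ∀ {x} → Integer x → Integer (- x)
integer-neg (ι-integer i) = subst Integer (sym (ι-neg i)) (ι-integer (ℤ.- i))

fromℕ-integer : ∀ n → Integer (fromℕ n)
fromℕ-integer n = subst Integer (sym (/1≡ι (+ n))) (ι-integer (+ n))

fromℕ-+ : ∀ m n → fromℕ (m ℕ.+ n) ≡ fromℕ m + fromℕ n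
fromℕ-+ m n = trans (/1≡ι (+ (m ℕ.+ n))) (trans (sym (ι-+ (+ m) (+ n)))
  (sym (cong₂ _+_ (/1≡ι (+ m)) (/1≡ι (+ n)))))

fromℕ-* : ∀ m n → fromℕ (m ℕ.* n) ≡ fromℕ m * fromℕ n
fromℕ-* m n = trans (/1≡ι (+ (m ℕ.* n))) (trans (cong ι (ℤ.pos-* m n)) (trans (sym (ι-* (+ m) (+ n)))
  (sym (cong₂ _*_ (/1≡ι (+ m)) (/1≡ι (+ n))))))

half : ∀ n → (∃[ k ] n ≡ k ℕ.+ k) ⊎ (∃[ k ] n ≡ suc (k ℕ.+ k))
half zero = inj₁ (0 , refl)
half (suc n) with half n
... | inj₁ (k , refl) = inj₂ (k , refl)
... | inj₂ (k , refl) = inj₁ (suc k , cong suc (sym (ℕ.+-suc k k)))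

n+n≢1+m+m : ∀ n m → n ℕ.+ n ≢ suc (m ℕ.+ m)
n+n≢1+m+m (suc n) zero    eq with () ← trans (sym (ℕ.+-suc n n)) (ℕ.suc-injective eq)
n+n≢1+m+m (suc n) (suc m) eq = n+n≢1+m+m n m (ℕ.suc-injective
  (trans (sym (ℕ.+-suc n n)) (trans (ℕ.suc-injective eq) (cong suc (ℕ.+-suc m m)))))

i+i≢1 : ∀ i → i ℤ.+ i ≢ + 1
i+i≢1 (+ n) eq = n+n≢1+m+m n 0 (ℤ.+-injective eq)

-- Z₍₂₎, the rationals with odd denominator 1 + 2d.
record Local (x : ℚ) : Set where
  constructor local
  field
    d         : ℚ
    d-integer : Integer d
    integer   : Integer (x * (1ℚ + fromℕ 2 * d))

record Even (x : ℚ) : Set where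
  constructor even
  field
    {w}     : ℚ
    w-local : Local w
    x≡2w    : x ≡ fromℕ 2 * w

record Odd (x : ℚ) : Set where
  constructor odd
  field
    {w}     : ℚ
    w-local : Local w
    x≡1+2w  : x ≡ 1ℚ + fromℕ 2 * w

integer⇒local : ∀ {x} → Integer x → Local x
integer⇒local {x} x∈ℤ = local 0ℚ (fromℕ-integer 0) (subst Integer
  (solve 1 (λ x → x := x :* (con 1ℚ :+ con (fromℕ 2) :* con 0ℚ)) refl x) x∈ℤ)

fromℕ-local : ∀ n → Local (fromℕ n)
fromℕ-local n = integer⇒local (fromℕ-integer n)

1-local : Local 1ℚ
1-local = fromℕ-local 1

odd-denominator : ∀ {d} → Integer d → Integer (1ℚ + fromℕ 2 * d)
odd-denominator d∈ℤ = integer-+ (fromℕ-integer 1) (integer-* (fromℕ-integer 2) d∈ℤ)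

-- The formula comes from `(1 + 2d)(1 + 2e) = 1 + 2(d + e + 2de)`.
common-denominator : ∀ {d e} → Integer d → Integer e → Integer (d + e + fromℕ 2 * (d * e))
common-denominator d∈ℤ e∈ℤ =
  integer-+ (integer-+ d∈ℤ e∈ℤ) (integer-* (fromℕ-integer 2) (integer-* d∈ℤ e∈ℤ))

local-+ : ∀ {x y} → Local x → Local y → Local (x + y)
local-+ {x} {y} (local d d∈ℤ xd) (local e e∈ℤ ye) =
  local (d + e + fromℕ 2 * (d * e)) (common-denominator d∈ℤ e∈ℤ) (subst Integer
    (solve 4 (λ x y d e → let 2d = con (fromℕ 2) :* d; 2e = con (fromℕ 2) :* e in
      x :* (con 1ℚ :+ 2d) :* (con 1ℚ :+ 2e) :+ y :* (con 1ℚ :+ 2e) :* (con 1ℚ :+ 2d) :=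
      (x :+ y) :* (con 1ℚ :+ con (fromℕ 2) :* (d :+ e :+ con (fromℕ 2) :* (d :* e))))
      refl x y d e)
    (integer-+ (integer-* xd (odd-denominator e∈ℤ)) (integer-* ye (odd-denominator d∈ℤ))))

local-* : ∀ {x y} → Local x → Local y → Local (x * y)
local-* {x} {y} (local d d∈ℤ xd) (local e e∈ℤ ye) =
  local (d + e + fromℕ 2 * (d * e)) (common-denominator d∈ℤ e∈ℤ) (subst Integer
    (solve 4 (λ x y d e → let 2d = con (fromℕ 2) :* d; 2e = con (fromℕ 2) :* e in
      x :* (con 1ℚ :+ 2d) :* (y :* (con 1ℚ :+ 2e)) :=
      (x :* y) :* (con 1ℚ :+ con (fromℕ 2) :* (d :+ e :+ con (fromℕ 2) :* (d :* e))))
      refl x y d e)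
    (integer-* xd ye))

local-neg : ∀ {x} → Local x → Local (- x)
local-neg {x} (local d d∈ℤ xd) = local d d∈ℤ
  (subst Integer (neg-distribˡ-* x (1ℚ + fromℕ 2 * d)) (integer-neg xd))

even⇒local : ∀ {x} → Even x → Local x
even⇒local (even w refl) = local-* (fromℕ-local 2) w

odd⇒local : ∀ {x} → Odd x → Local x
odd⇒local (odd w refl) = local-+ 1-local (local-* (fromℕ-local 2) w)

even-+ : ∀ {x y} → Even x → Even y → Even (x + y)
even-+ (even {v} v∈ refl) (even {w} w∈ refl) =
  even (local-+ v∈ w∈) (sym (*-distribˡ-+ (fromℕ 2) v w))

even-neg : ∀ {x} → Even x → Even (- x)
even-neg (even {w} w∈ refl) = even (local-neg w∈) (neg-distribʳ-* (fromℕ 2) w)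

even-*ʳ : ∀ {x y} → Even x → Local y → Even (x * y)
even-*ʳ {y = y} (even {w} w∈ refl) y∈ = even (local-* w∈ y∈) (*-assoc (fromℕ 2) w y)

even-*ˡ : ∀ {x y} → Local x → Even y → Even (x * y)
even-*ˡ {x} {y} x∈ y-even = subst Even (*-comm y x) (even-*ʳ y-even x∈)

0-even : Even 0ℚ
0-even = even (fromℕ-local 0) refl

1-odd : Odd 1ℚ
1-odd = odd (fromℕ-local 0) refl

4-even : Even (fromℕ 4)
4-even = even (fromℕ-local 2) refl

odd-+-even : ∀ {x y} → Odd x → Even y → Odd (x + y)
odd-+-even (odd {v} v∈ refl) (even {w} w∈ refl) = odd (local-+ v∈ w∈)
  (solve 2 (λ v w → con 1ℚ :+ con (fromℕ 2) :* v :+ con (fromℕ 2) :* w :=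
                    con 1ℚ :+ con (fromℕ 2) :* (v :+ w)) refl v w)

even-+-odd : ∀ {x y} → Even x → Odd y → Odd (x + y)
even-+-odd {x} {y} x-even y-odd = subst Odd (+-comm y x) (odd-+-even y-odd x-even)

odd-+-odd : ∀ {x y} → Odd x → Odd y → Even (x + y)
odd-+-odd (odd {v} v∈ refl) (odd {w} w∈ refl) = even (local-+ 1-local (local-+ v∈ w∈))
  (solve 2 (λ v w → con 1ℚ :+ con (fromℕ 2) :* v :+ (con 1ℚ :+ con (fromℕ 2) :* w) :=
                    con (fromℕ 2) :* (con 1ℚ :+ (v :+ w))) refl v w)

odd-* : ∀ {x y} → Odd x → Odd y → Odd (x * y)
odd-* (odd {v} v∈ refl) (odd {w} w∈ refl) = odd
  (local-+ (local-+ v∈ w∈) (local-* (fromℕ-local 2) (local-* v∈ w∈)))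
  (solve 2 (λ v w → (con 1ℚ :+ con (fromℕ 2) :* v) :* (con 1ℚ :+ con (fromℕ 2) :* w) :=
     con 1ℚ :+ con (fromℕ 2) :* (v :+ w :+ con (fromℕ 2) :* (v :* w))) refl v w)

odd-neg : ∀ {x} → Odd x → Odd (- x)
odd-neg (odd {w} w∈ refl) = odd (local-neg (local-+ 1-local w∈))
  (solve 1 (λ w → :- (con 1ℚ :+ con (fromℕ 2) :* w) :=
     con 1ℚ :+ con (fromℕ 2) :* (:- (con 1ℚ :+ w))) refl w)

1-not-even : ¬ Even 1ℚ
1-not-even (even {w} (local d d∈ℤ wd∈ℤ) 1≡2w) = impossible twice
  (integer-+ wd∈ℤ (integer-neg d∈ℤ))
  where
  -- Clearing the denominator of `w` in `1 = 2w` gives `1 + 2d = 2w(1 + 2d)`, so the integer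
  -- `w(1 + 2d) - d` would be one half.
  twice : w * (1ℚ + fromℕ 2 * d) - d + (w * (1ℚ + fromℕ 2 * d) - d) ≡ 1ℚ
  twice = trans
    (solve 2 (λ w d → let m = w :* (con 1ℚ :+ con (fromℕ 2) :* d) :- d in
      m :+ m := con (fromℕ 2) :* w :* (con 1ℚ :+ con (fromℕ 2) :* d) :- con (fromℕ 2) :* d)
      refl w d)
    (trans (cong (λ t → t * (1ℚ + fromℕ 2 * d) - fromℕ 2 * d) (sym 1≡2w))
      (solve 1 (λ d → con 1ℚ :* (con 1ℚ :+ con (fromℕ 2) :* d) :- con (fromℕ 2) :* d := con 1ℚ)
        refl d))
  impossible : ∀ {m} → m + m ≡ 1ℚ → Integer m → ⊥
  impossible eq (ι-integer i) = i+i≢1 i (ι-injective (trans (sym (ι-+ i i)) eq))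

even⇒¬odd : ∀ {x} → Even x → ¬ Odd x
even⇒¬odd {x} x-even (odd {w} w∈ refl) = 1-not-even (subst Even
  (solve 1 (λ w → con 1ℚ :+ con (fromℕ 2) :* w :+ (:- (con (fromℕ 2) :* w)) := con 1ℚ) refl w)
  (even-+ x-even (even-neg (even-*ʳ (even 1-local refl) w∈))))

-- Reduction to the projective line over the field of two elements

data Reduction (x : ℚ) : Set where
  isEven  : Even x → Reduction x
  isOdd   : Odd x → Reduction x
  isPolar : ∀ z → Even z → x * z ≡ 1ℚ → Reduction x

not-both-even : ∀ {m n} → Coprime (m ℕ.+ m) (n ℕ.+ n) → ⊥
not-both-even {m} {n} c = contradiction (c {2} (2∣m+m m , 2∣m+m n)) λ ()
  where
  2∣m+m : ∀ m → 2 ∣ m ℕ.+ m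
  2∣m+m m = divides m (trans (cong (m ℕ.+_) (sym (ℕ.+-identityʳ m))) (ℕ.*-comm 2 m))

ι-sign : ∀ i → ι i ≡ fromℕ ℤ.∣ i ∣ ⊎ ι i ≡ - fromℕ ℤ.∣ i ∣
ι-sign (+ n)     = inj₁ (sym (/1≡ι (+ n)))
ι-sign -[1+ n ]  = inj₂ (cong -_ (sym (/1≡ι (+ suc n))))

fromℕ-k+k : ∀ k → fromℕ (k ℕ.+ k) ≡ fromℕ 2 * fromℕ k
fromℕ-k+k k = trans (fromℕ-+ k k)
  (solve 1 (λ k → k :+ k := con (fromℕ 2) :* k) refl (fromℕ k))

fromℕ-1+k+k : ∀ k → fromℕ (suc (k ℕ.+ k)) ≡ 1ℚ + fromℕ 2 * fromℕ k
fromℕ-1+k+k k = trans (fromℕ-+ 1 (k ℕ.+ k)) (cong (λ t → 1ℚ + t) (fromℕ-k+k k))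

-- The even case also keeps half of the absolute value as a natural number, because lowest terms are
-- expressed by coprimality of absolute values.
data ParityOf (i : ℤ) : Set where
  evenℤ : ∀ k {m} → ℤ.∣ i ∣ ≡ k ℕ.+ k → Integer m → ι i ≡ fromℕ 2 * m → ParityOf i
  oddℤ  : ∀ {m} → Integer m → ι i ≡ 1ℚ + fromℕ 2 * m → ParityOf i

parity-of : ∀ i → ParityOf i
parity-of i = classify (half ℤ.∣ i ∣) (ι-sign i)
  where
  neg-odd : ∀ k → - (1ℚ + fromℕ 2 * fromℕ k) ≡ 1ℚ + fromℕ 2 * (- (1ℚ + fromℕ k))
  neg-odd k = solve 1 (λ k → :- (con 1ℚ :+ con (fromℕ 2) :* k) :=
    con 1ℚ :+ con (fromℕ 2) :* (:- (con 1ℚ :+ k))) refl (fromℕ k)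
  ∣i∣-even : ∀ k → ℤ.∣ i ∣ ≡ k ℕ.+ k → fromℕ ℤ.∣ i ∣ ≡ fromℕ 2 * fromℕ k
  ∣i∣-even k eq = trans (cong fromℕ eq) (fromℕ-k+k k)
  ∣i∣-odd : ∀ k → ℤ.∣ i ∣ ≡ suc (k ℕ.+ k) → fromℕ ℤ.∣ i ∣ ≡ 1ℚ + fromℕ 2 * fromℕ k
  ∣i∣-odd k eq = trans (cong fromℕ eq) (fromℕ-1+k+k k)
  classify : (∃[ k ] ℤ.∣ i ∣ ≡ k ℕ.+ k) ⊎ (∃[ k ] ℤ.∣ i ∣ ≡ suc (k ℕ.+ k)) →
             ι i ≡ fromℕ ℤ.∣ i ∣ ⊎ ι i ≡ - fromℕ ℤ.∣ i ∣ → ParityOf i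
  classify (inj₁ (k , eq)) (inj₁ p) =
    evenℤ k eq (fromℕ-integer k) (trans p (∣i∣-even k eq))
  classify (inj₁ (k , eq)) (inj₂ p) = evenℤ k eq (integer-neg (fromℕ-integer k))
    (trans p (trans (cong -_ (∣i∣-even k eq)) (neg-distribʳ-* (fromℕ 2) (fromℕ k))))
  classify (inj₂ (k , eq)) (inj₁ p) = oddℤ (fromℕ-integer k) (trans p (∣i∣-odd k eq))
  classify (inj₂ (k , eq)) (inj₂ p) =
    oddℤ (integer-neg (integer-+ (fromℕ-integer 1) (fromℕ-integer k)))
      (trans p (trans (cong -_ (∣i∣-odd k eq)) (neg-odd k)))

even-quotient : ∀ {z d m} → Integer d → Integer m → z * (1ℚ + fromℕ 2 * d) ≡ fromℕ 2 * m → Even z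
even-quotient {z} {d} {m} d∈ℤ m∈ℤ eq = even {w = z * ½}
  (local d d∈ℤ (subst Integer (sym (trans
    (solve 2 (λ z t → z :* con ½ :* t := con ½ :* (z :* t)) refl z (1ℚ + fromℕ 2 * d))
    (trans (cong (½ *_) eq) (solve 1 (λ m → con ½ :* (con (fromℕ 2) :* m) := m) refl m)))) m∈ℤ))
  (solve 1 (λ z → z := con (fromℕ 2) :* (z :* con ½)) refl z)

odd-quotient : ∀ {x d m} → Integer d → Integer m →
               x * (1ℚ + fromℕ 2 * d) ≡ 1ℚ + fromℕ 2 * m → Odd x
odd-quotient {x} {d} {m} d∈ℤ m∈ℤ eq =
  subst Odd (solve 1 (λ x → con 1ℚ :+ (x :- con 1ℚ) := x) refl x)
    -- `x - 1` has the numerator `(1 + 2m) - (1 + 2d)` over the same denominator.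
    (odd-+-even 1-odd (even-quotient {z = x - 1ℚ} {m = m - d} d∈ℤ (integer-+ m∈ℤ (integer-neg d∈ℤ))
      (trans
        (solve 2 (λ x d → (x :- con 1ℚ) :* (con 1ℚ :+ con (fromℕ 2) :* d) :=
          x :* (con 1ℚ :+ con (fromℕ 2) :* d) :- (con 1ℚ :+ con (fromℕ 2) :* d)) refl x d)
        (trans (cong (_- (1ℚ + fromℕ 2 * d)) eq)
          (solve 2 (λ m d → con 1ℚ :+ con (fromℕ 2) :* m :- (con 1ℚ :+ con (fromℕ 2) :* d) :=
            con (fromℕ 2) :* (m :- d)) refl m d)))))

polar-quotient : ∀ {x d m} → Integer d → Integer m →
                 x * (fromℕ 2 * d) ≡ 1ℚ + fromℕ 2 * m → Reduction x
polar-quotient {x} {d} {m} d∈ℤ m∈ℤ eq =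
  -- Numerator and denominator exchange roles: `1/ x` is `2d` over the odd `1 + 2m`.
  isPolar (1/ x) (even-quotient m∈ℤ d∈ℤ (begin
    1/ x * (1ℚ + fromℕ 2 * m)   ≡⟨ cong (1/ x *_) eq ⟨
    1/ x * (x * (fromℕ 2 * d))  ≡⟨ *-assoc (1/ x) x (fromℕ 2 * d) ⟨
    1/ x * x * (fromℕ 2 * d)    ≡⟨ cong (_* (fromℕ 2 * d)) (*-inverseˡ x) ⟩
    1ℚ * (fromℕ 2 * d)          ≡⟨ *-identityˡ _ ⟩
    fromℕ 2 * d                 ∎)) (*-inverseʳ x)
  where
  open ≡-Reasoning
  x≢0 : x ≢ 0ℚ
  x≢0 x≡0 = even⇒¬odd 0-even (odd (integer⇒local m∈ℤ)
    (trans (sym (trans (cong (_* (fromℕ 2 * d)) x≡0) (*-zeroˡ (fromℕ 2 * d)))) eq))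
  instance _ = ≢-nonZero x≢0

reduction : ∀ x → Reduction x
reduction x@(mkℚ n d-1 c) = cases (parity-of n) (parity-of (↧ x))
  where
  quotient : ∀ {M N} → ι n ≡ N → ι (↧ x) ≡ M → x * M ≡ N
  quotient refl refl = *↧≡↥ x
  cases : ParityOf n → ParityOf (↧ x) → Reduction x
  cases (evenℤ j n≡ _ _) (evenℤ k d≡ _ _) =
    ⊥-elim (not-both-even {j} {k} (subst₂ Coprime n≡ d≡ (Coprime.recompute c)))
  cases (evenℤ _ _ m∈ℤ N≡) (oddℤ d∈ℤ D≡) = isEven (even-quotient d∈ℤ m∈ℤ (quotient N≡ D≡))
  cases (oddℤ m∈ℤ N≡) (oddℤ d∈ℤ D≡)      = isOdd (odd-quotient d∈ℤ m∈ℤ (quotient N≡ D≡))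
  cases (oddℤ m∈ℤ N≡) (evenℤ _ _ d∈ℤ D≡) = polar-quotient d∈ℤ m∈ℤ (quotient N≡ D≡)

-- Torsion of y² = x³ + ax for a ≡ 1 mod 4

-- The discriminant condition is a parameter, so that `E` is definitionally the curve of the theorem
-- once `a` is specialised.
module CurveArithmetic (a : ℚ) {κ : ℚ} (κ-local : Local κ) (a≡1+4κ : a ≡ 1ℚ + fromℕ 4 * κ)
  (Δ≢0 : - fromℕ 16 * (fromℕ 4 * (a * a * a) + fromℕ 27 * (0ℚ * 0ℚ)) ≢ 0ℚ) where

  E : EllipticCurve
  E = record { a = a ; b = 0ℚ ; Δ≢0 = Δ≢0 }

  open Points E hiding (rationalPoints)
  open GroupLaw E

  a-odd : Odd a
  a-odd = odd (local-* (fromℕ-local 2) κ-local) (trans a≡1+4κ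
    (cong (λ t → 1ℚ + t) (*-assoc (fromℕ 2) (fromℕ 2) κ)))

  a-local : Local a
  a-local = odd⇒local a-odd

  a≢0 : a ≢ 0ℚ
  a≢0 a≡0 = even⇒¬odd 0-even (subst Odd a≡0 a-odd)

  -- If x is odd then x² ≡ a ≡ 1 mod 4, so x³ + ax is twice an odd number.
  x³+ax≡2t : ∀ {x} → Odd x → ∃[ t ] Odd t × x * x * x + a * x + 0ℚ ≡ fromℕ 2 * t
  x³+ax≡2t {x} x-odd@(odd {w} w∈ x≡) = x * (1ℚ + fromℕ 2 * (w + w * w + κ)) ,
    odd-* x-odd (odd (local-+ (local-+ w∈ (local-* w∈ w∈)) κ-local) refl) ,
    trans (solve 2 (λ x a → x :* x :* x :+ a :* x :+ con 0ℚ := x :* (x :* x :+ a)) refl x a)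
      (trans (cong (x *_) (trans (cong₂ (λ x a → x * x + a) x≡ a≡1+4κ)
        (solve 2 (λ w k → let x = con 1ℚ :+ con (fromℕ 2) :* w in
          x :* x :+ (con 1ℚ :+ con (fromℕ 4) :* k) :=
          con (fromℕ 2) :* (con 1ℚ :+ con (fromℕ 2) :* (w :+ w :* w :+ k))) refl w κ)))
      (solve 2 (λ x t → x :* (con (fromℕ 2) :* t) := con (fromℕ 2) :* (x :* t)) refl x
        (1ℚ + fromℕ 2 * (w + w * w + κ))))

  -- The valuation of `2t` at 2 is one, whereas that of a nonzero square is even; the three cases of
  -- `Reduction` stand in for valuations.
  square≢2odd : ∀ y {t} → Odd t → y * y ≢ fromℕ 2 * t
  square≢2odd y {t} t-odd eq = cases (reduction y)
    where
    2-even : Even (fromℕ 2)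
    2-even = even 1-local refl
    cases : Reduction y → ⊥
    cases (isEven (even {w} w∈ y≡2w)) = even⇒¬odd
      (subst Even (x-y≡0⇒x≡y _ _ (*-cancelˡ-≡0 {fromℕ 2} (λ ()) (trans
          (solve 2 (λ w t → con (fromℕ 2) :* (con (fromℕ 2) :* (w :* w) :- t) :=
            (con (fromℕ 2) :* w) :* (con (fromℕ 2) :* w) :- con (fromℕ 2) :* t) refl w t)
          (x≡y⇒x-y≡0 (trans (sym (cong₂ _*_ y≡2w y≡2w)) eq)))))
        (even-*ʳ 2-even (local-* w∈ w∈))) t-odd
    cases (isOdd y-odd) =
      even⇒¬odd (even-*ʳ 2-even (odd⇒local t-odd)) (subst Odd eq (odd-* y-odd y-odd))
    cases (isPolar z z-even yz≡1) = 1-not-even (subst Even (begin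
      fromℕ 2 * t * z * z  ≡⟨ cong (λ u → u * z * z) eq ⟨
      y * y * z * z        ≡⟨ solve 2 (λ y z → y :* y :* z :* z := (y :* z) :* (y :* z)) refl y z ⟩
      (y * z) * (y * z)    ≡⟨ cong₂ _*_ yz≡1 yz≡1 ⟩
      1ℚ * 1ℚ              ∎)
      (even-*ʳ (even-*ʳ (even-*ʳ 2-even (odd⇒local t-odd)) (even⇒local z-even)) (even⇒local z-even)))
      where open ≡-Reasoning

  x-not-odd : ∀ {x y} → OnCurve x y → ¬ Odd x
  x-not-odd {x} {y} e x-odd = let t , t-odd , eq = x³+ax≡2t x-odd in
    square≢2odd y t-odd (trans e eq)

  -- The coordinate z is that of whichever of (x , y) and (x , y) + (0 , 0) reduces
  -- to (0 , 0) modulo 2; translation by (0 , 0) acts on abscissas as x ↦ a / x.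
  data Coord (x : ℚ) : Parity → ℚ → Set where
    near∞ : ∀ {z} → Even z → x * z ≡ a → Coord x 0ℙ z
    near0 : Even x → Coord x 1ℙ x

  coord-even : ∀ {x π z} → Coord x π z → Even z
  coord-even (near∞ z-even _) = z-even
  coord-even (near0 x-even)   = x-even

  coord : ∀ {x y} → OnCurve x y → ∃[ π ] ∃[ z ] Coord x π z
  coord {x} {y} e = cases (reduction x)
    where
    cases : Reduction x → ∃[ π ] ∃[ z ] Coord x π z
    cases (isEven x-even)        = 1ℙ , x , near0 x-even
    cases (isOdd x-odd)          = ⊥-elim (x-not-odd {y = y} e x-odd)
    cases (isPolar z z-even xz≡1) = 0ℙ , z * a , near∞ (even-*ʳ z-even a-local)
      (trans (sym (*-assoc x z a)) (trans (cong (_* a) xz≡1) (*-identityˡ a)))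

  -- The two charts do not overlap: if `x` and `z` were both even, so would be their product, the
  -- odd number `a`.
  coord-unique : ∀ {x π π′ z z′} → Coord x π z → Coord x π′ z′ → π ≡ π′ × z ≡ z′
  coord-unique {x} (near∞ {z} _ xz≡a) (near∞ {z′} _ xz′≡a) = refl ,
    x-y≡0⇒x≡y z z′ (*-cancelˡ-≡0 {x} x≢0 (trans
      (solve 3 (λ x z z′ → x :* (z :- z′) := x :* z :- x :* z′) refl x z z′)
      (x≡y⇒x-y≡0 (trans xz≡a (sym xz′≡a)))))
    where
    x≢0 : x ≢ 0ℚ
    x≢0 x≡0 = a≢0 (trans (sym xz≡a) (trans (cong (_* z) x≡0) (*-zeroˡ z)))
  coord-unique (near∞ z-even xz≡a) (near0 x-even) =
    ⊥-elim (even⇒¬odd (subst Even xz≡a (even-*ʳ x-even (even⇒local z-even))) a-odd)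
  coord-unique (near0 x-even) (near∞ z-even xz≡a) =
    ⊥-elim (even⇒¬odd (subst Even xz≡a (even-*ʳ x-even (even⇒local z-even))) a-odd)
  coord-unique (near0 _) (near0 _) = refl , refl

  -- The relation between collinear abscissas

  -- The result of eliminating s and c from Line s c x₁ x₂ x₃.
  record Collinear (x₁ x₂ x₃ : ℚ) : Set where
    constructor collinear
    field
      relation : (x₁ * x₂ + x₁ * x₃ + x₂ * x₃ - a) * (x₁ * x₂ + x₁ * x₃ + x₂ * x₃ - a)
                 ≡ fromℕ 4 * ((x₁ + x₂ + x₃) * (x₁ * x₂ * x₃))

  line⇒collinear : ∀ {s c x₁ x₂ x₃} → Line s c x₁ x₂ x₃ → Collinear x₁ x₂ x₃
  line⇒collinear {s} {c} {x₁} {x₂} {x₃} L = collinear (begin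
    (e₂ - a) * (e₂ - a)                                    ≡⟨ cong (λ t → (e₂ - t) * (e₂ - t)) e₂≡ ⟨
    (e₂ - (e₂ + fromℕ 2 * (s * c))) * (e₂ - (e₂ + fromℕ 2 * (s * c)))
      ≡⟨ solve 3 (λ e s c → let t = e :- (e :+ con (fromℕ 2) :* (s :* c)) in
           t :* t := con (fromℕ 4) :* ((s :* s) :* (c :* c))) refl e₂ s c ⟩
    fromℕ 4 * ((s * s) * (c * c))                          ≡⟨ cong₂ (λ u v → fromℕ 4 * (u * v)) e₁≡ e₃≡ ⟨
    fromℕ 4 * ((x₁ + x₂ + x₃) * (x₁ * x₂ * x₃ + 0ℚ))
      ≡⟨ cong (λ t → fromℕ 4 * ((x₁ + x₂ + x₃) * t)) (+-identityʳ (x₁ * x₂ * x₃)) ⟩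
    fromℕ 4 * ((x₁ + x₂ + x₃) * (x₁ * x₂ * x₃))            ∎)
    where
    open ≡-Reasoning
    open Line L
    e₂ = x₁ * x₂ + x₁ * x₃ + x₂ * x₃

  collinear-swap₂₃ : ∀ {x₁ x₂ x₃} → Collinear x₁ x₂ x₃ → Collinear x₁ x₃ x₂
  collinear-swap₂₃ {x₁} {x₂} {x₃} (collinear eq) = collinear (trans
    (solve 4 (λ x y z a →
      let t = x :* z :+ x :* y :+ z :* y :- a
          u = x :* y :+ x :* z :+ y :* z :- a in
      t :* t := u :* u) refl x₁ x₂ x₃ a)
    (trans eq (solve 3 (λ x y z → con (fromℕ 4) :* ((x :+ y :+ z) :* (x :* y :* z)) :=
      con (fromℕ 4) :* ((x :+ z :+ y) :* (x :* z :* y))) refl x₁ x₂ x₃)))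

  collinear-swap₁₂ : ∀ {x₁ x₂ x₃} → Collinear x₁ x₂ x₃ → Collinear x₂ x₁ x₃
  collinear-swap₁₂ {x₁} {x₂} {x₃} (collinear eq) = collinear (trans
    (solve 4 (λ x y z a →
      let t = y :* x :+ y :* z :+ x :* z :- a
          u = x :* y :+ x :* z :+ y :* z :- a in
      t :* t := u :* u) refl x₁ x₂ x₃ a)
    (trans eq (solve 3 (λ x y z → con (fromℕ 4) :* ((x :+ y :+ z) :* (x :* y :* z)) :=
      con (fromℕ 4) :* ((y :+ x :+ z) :* (y :* x :* z))) refl x₁ x₂ x₃)))

  -- Modulo 2 the relation would read `a² = 0`. Together with `not-one-near0` this excludes the
  -- patterns in which the reductions do not add up to zero.
  not-all-near0 : ∀ {x₁ x₂ x₃} → Even x₁ → Even x₂ → Even x₃ → ¬ Collinear x₁ x₂ x₃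
  not-all-near0 {x₁} {x₂} {x₃} p₁ p₂ p₃ (collinear eq) = even⇒¬odd
    (even-*ʳ 4-even (local-* (local-+ (local-+ l₁ l₂) (even⇒local p₃))
      (local-* (local-* l₁ l₂) (even⇒local p₃))))
    (subst Odd eq (odd-* e₂-a-odd e₂-a-odd))
    where
    l₁ = even⇒local p₁
    l₂ = even⇒local p₂
    e₂-a-odd : Odd (x₁ * x₂ + x₁ * x₃ + x₂ * x₃ - a)
    e₂-a-odd = even-+-odd (even-+ (even-+ (even-*ʳ p₁ l₂) (even-*ˡ l₁ p₃)) (even-*ˡ l₂ p₃))
      (odd-neg a-odd)

  not-one-near0 : ∀ {x₁ x₂ x₃ z₁ z₂} → Even z₁ → x₁ * z₁ ≡ a → Even z₂ → x₂ * z₂ ≡ a → Even x₃ →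
                  ¬ Collinear x₁ x₂ x₃
  not-one-near0 {x₁} {x₂} {x₃} {z₁} {z₂} p₁ q₁ p₂ q₂ p₃ (collinear eq) = even⇒¬odd
    (even-*ʳ 4-even (local-*
      (local-+ (local-+ (local-* a-local l₂) (local-* a-local l₁)) (local-* (local-* l₃ l₁) l₂))
      (local-* (local-* a-local a-local) l₃)))
    (subst Odd (cleared q₁ q₂) (odd-* M-odd M-odd))
    where
    l₁ = even⇒local p₁
    l₂ = even⇒local p₂
    l₃ = even⇒local p₃
    M-odd : Odd (a * a + (x₃ * (a * z₂ + a * z₁) - a * z₁ * z₂))
    M-odd = odd-+-even (odd-* a-odd a-odd) (even-+
      (even-*ʳ p₃ (local-+ (local-* a-local l₂) (local-* a-local l₁)))
      (even-neg (even-*ˡ (local-* a-local l₁) p₂)))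
    -- Multiplying by `(z₁ z₂)²` clears the poles. The products `u` and `v` stay variables so that
    -- the claim is a polynomial identity; they become `a` only in use.
    cleared : ∀ {u v} → x₁ * z₁ ≡ u → x₂ * z₂ ≡ v →
      (u * v + (x₃ * (u * z₂ + v * z₁) - a * z₁ * z₂)) *
      (u * v + (x₃ * (u * z₂ + v * z₁) - a * z₁ * z₂))
      ≡ fromℕ 4 * ((u * z₂ + v * z₁ + x₃ * z₁ * z₂) * (u * v * x₃))
    cleared refl refl = ≡-from
      (solve 6 (λ a x₁ x₂ x₃ z₁ z₂ →
        let u = x₁ :* z₁; v = x₂ :* z₂
            M = u :* v :+ (x₃ :* (u :* z₂ :+ v :* z₁) :- a :* z₁ :* z₂)
            e = x₁ :* x₂ :+ x₁ :* x₃ :+ x₂ :* x₃ :- a in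
        M :* M :- con (fromℕ 4) :* ((u :* z₂ :+ v :* z₁ :+ x₃ :* z₁ :* z₂) :* (u :* v :* x₃)) :=
        (z₁ :* z₂) :* (z₁ :* z₂) :* (e :* e :- con (fromℕ 4) :* ((x₁ :+ x₂ :+ x₃) :* (x₁ :* x₂ :* x₃))))
        refl a x₁ x₂ x₃ z₁ z₂)
      (*-diff≡0 ((z₁ * z₂) * (z₁ * z₂)) eq)

  -- What `Collinear` becomes when one or all three abscissas are replaced through `x ↦ a / x`. Its
  -- terms of lowest degree give `(z₁ + z₂ + z₃)² = 4 (z₁ z₂ + z₁ z₃ + z₂ z₃)`, which says that
  -- suitable square roots of the coordinates add up to zero.
  record Balanced (z₁ z₂ z₃ : ℚ) : Set where
    constructor balanced
    field
      relation : (z₁ * z₂ * z₃ - a * (z₁ + z₂ + z₃)) * (z₁ * z₂ * z₃ - a * (z₁ + z₂ + z₃))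
                 ≡ fromℕ 4 * (a * a * (z₁ * z₂ + z₁ * z₃ + z₂ * z₃))

  balanced-swap₂₃ : ∀ {z₁ z₂ z₃} → Balanced z₁ z₂ z₃ → Balanced z₁ z₃ z₂
  balanced-swap₂₃ {z₁} {z₂} {z₃} (balanced eq) = balanced (trans
    (solve 4 (λ x y z a →
      let t = x :* z :* y :- a :* (x :+ z :+ y)
          u = x :* y :* z :- a :* (x :+ y :+ z) in
      t :* t := u :* u) refl z₁ z₂ z₃ a)
    (trans eq (solve 4 (λ x y z a → con (fromℕ 4) :* (a :* a :* (x :* y :+ x :* z :+ y :* z)) :=
      con (fromℕ 4) :* (a :* a :* (x :* z :+ x :* y :+ z :* y))) refl z₁ z₂ z₃ a)))

  balanced-swap₁₂ : ∀ {z₁ z₂ z₃} → Balanced z₁ z₂ z₃ → Balanced z₂ z₁ z₃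
  balanced-swap₁₂ {z₁} {z₂} {z₃} (balanced eq) = balanced (trans
    (solve 4 (λ x y z a →
      let t = y :* x :* z :- a :* (y :+ x :+ z)
          u = x :* y :* z :- a :* (x :+ y :+ z) in
      t :* t := u :* u) refl z₁ z₂ z₃ a)
    (trans eq (solve 4 (λ x y z a → con (fromℕ 4) :* (a :* a :* (x :* y :+ x :* z :+ y :* z)) :=
      con (fromℕ 4) :* (a :* a :* (y :* x :+ y :* z :+ x :* z))) refl z₁ z₂ z₃ a)))

  balanced-∞∞∞ : ∀ {x₁ x₂ x₃ z₁ z₂ z₃} → x₁ * z₁ ≡ a → x₂ * z₂ ≡ a → x₃ * z₃ ≡ a →
                 Collinear x₁ x₂ x₃ → Balanced z₁ z₂ z₃
  balanced-∞∞∞ {x₁} {x₂} {x₃} {z₁} {z₂} {z₃} q₁ q₂ q₃ (collinear eq) =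
    -- Clearing all three poles leaves a common factor `a²` to cancel.
    balanced (x-y≡0⇒x≡y _ _ (*-cancelˡ-≡0 {a * a} (λ a²≡0 → a≢0 (x²≡0⇒x≡0 a a²≡0)) (trans
      (solve 4 (λ a z₁ z₂ z₃ →
        let t = z₁ :* z₂ :* z₃ :- a :* (z₁ :+ z₂ :+ z₃)
            M = a :* a :* z₃ :+ a :* a :* z₂ :+ a :* a :* z₁ :- a :* (z₁ :* z₂ :* z₃) in
        a :* a :* (t :* t :- con (fromℕ 4) :* (a :* a :* (z₁ :* z₂ :+ z₁ :* z₃ :+ z₂ :* z₃))) :=
        M :* M :-
        con (fromℕ 4) :* ((a :* z₂ :* z₃ :+ a :* z₁ :* z₃ :+ a :* z₁ :* z₂) :* (a :* a :* a)))
        refl a z₁ z₂ z₃)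
      (x≡y⇒x-y≡0 (cleared q₁ q₂ q₃)))))
    where
    cleared : ∀ {u v w} → x₁ * z₁ ≡ u → x₂ * z₂ ≡ v → x₃ * z₃ ≡ w →
      (u * v * z₃ + u * w * z₂ + v * w * z₁ - a * (z₁ * z₂ * z₃)) *
      (u * v * z₃ + u * w * z₂ + v * w * z₁ - a * (z₁ * z₂ * z₃))
      ≡ fromℕ 4 * ((u * z₂ * z₃ + v * z₁ * z₃ + w * z₁ * z₂) * (u * v * w))
    cleared refl refl refl = ≡-from
      (solve 7 (λ a x₁ x₂ x₃ z₁ z₂ z₃ →
        let u = x₁ :* z₁; v = x₂ :* z₂; w = x₃ :* z₃
            M = u :* v :* z₃ :+ u :* w :* z₂ :+ v :* w :* z₁ :- a :* (z₁ :* z₂ :* z₃)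
            e = x₁ :* x₂ :+ x₁ :* x₃ :+ x₂ :* x₃ :- a in
        M :* M :-
        con (fromℕ 4) :* ((u :* z₂ :* z₃ :+ v :* z₁ :* z₃ :+ w :* z₁ :* z₂) :* (u :* v :* w)) :=
        (z₁ :* z₂ :* z₃) :* (z₁ :* z₂ :* z₃) :*
        (e :* e :- con (fromℕ 4) :* ((x₁ :+ x₂ :+ x₃) :* (x₁ :* x₂ :* x₃))))
        refl a x₁ x₂ x₃ z₁ z₂ z₃)
      (*-diff≡0 ((z₁ * z₂ * z₃) * (z₁ * z₂ * z₃)) eq)

  -- After the pole is cleared, the square on the left differs from that in `Balanced` by the sign
  -- of `a (x₂ + x₃)`; the difference of the two squares turns the right side into the symmetric
  -- one.
  balanced-∞00 : ∀ {x₁ x₂ x₃ z₁} → x₁ * z₁ ≡ a → Collinear x₁ x₂ x₃ → Balanced z₁ x₂ x₃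
  balanced-∞00 {x₁} {x₂} {x₃} {z₁} q₁ (collinear eq) = balanced (≡-from
    (solve 4 (λ a z₁ x₂ x₃ →
      let t = z₁ :* x₂ :* x₃ :- a :* (z₁ :+ x₂ :+ x₃)
          M = a :* (x₂ :+ x₃) :+ z₁ :* x₂ :* x₃ :- a :* z₁ in
      t :* t :- con (fromℕ 4) :* (a :* a :* (z₁ :* x₂ :+ z₁ :* x₃ :+ x₂ :* x₃)) :=
      M :* M :- con (fromℕ 4) :* ((a :+ z₁ :* x₂ :+ z₁ :* x₃) :* (a :* x₂ :* x₃)))
      refl a z₁ x₂ x₃)
    (x≡y⇒x-y≡0 (cleared q₁)))
    where
    cleared : ∀ {u} → x₁ * z₁ ≡ u →
      (u * (x₂ + x₃) + z₁ * x₂ * x₃ - a * z₁) * (u * (x₂ + x₃) + z₁ * x₂ * x₃ - a * z₁)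
      ≡ fromℕ 4 * ((u + z₁ * x₂ + z₁ * x₃) * (u * x₂ * x₃))
    cleared refl = ≡-from
      (solve 5 (λ a x₁ x₂ x₃ z₁ →
        let u = x₁ :* z₁
            M = u :* (x₂ :+ x₃) :+ z₁ :* x₂ :* x₃ :- a :* z₁
            e = x₁ :* x₂ :+ x₁ :* x₃ :+ x₂ :* x₃ :- a in
        M :* M :- con (fromℕ 4) :* ((u :+ z₁ :* x₂ :+ z₁ :* x₃) :* (u :* x₂ :* x₃)) :=
        z₁ :* z₁ :* (e :* e :- con (fromℕ 4) :* ((x₁ :+ x₂ :+ x₃) :* (x₁ :* x₂ :* x₃))))
        refl a x₁ x₂ x₃ z₁)
      (*-diff≡0 (z₁ * z₁) eq)

  coord-collinear : ∀ {x₁ x₂ x₃ π₁ π₂ π₃ z₁ z₂ z₃} → Collinear x₁ x₂ x₃ →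
    Coord x₁ π₁ z₁ → Coord x₂ π₂ z₂ → Coord x₃ π₃ z₃ →
    π₃ ≡ π₁ ℙ.+ π₂ × Balanced z₁ z₂ z₃
  coord-collinear C (near∞ _ q₁) (near∞ _ q₂) (near∞ _ q₃) = refl , balanced-∞∞∞ q₁ q₂ q₃ C
  coord-collinear C (near∞ p₁ q₁) (near∞ p₂ q₂) (near0 p₃) = ⊥-elim (not-one-near0 p₁ q₁ p₂ q₂ p₃ C)
  coord-collinear C (near∞ p₁ q₁) (near0 p₂) (near∞ p₃ q₃) =
    ⊥-elim (not-one-near0 p₁ q₁ p₃ q₃ p₂ (collinear-swap₂₃ C))
  coord-collinear C (near0 p₁) (near∞ p₂ q₂) (near∞ p₃ q₃) =
    ⊥-elim (not-one-near0 p₂ q₂ p₃ q₃ p₁ (collinear-swap₂₃ (collinear-swap₁₂ C)))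
  coord-collinear C (near∞ _ q₁) (near0 _) (near0 _) = refl , balanced-∞00 q₁ C
  coord-collinear C (near0 _) (near∞ _ q₂) (near0 _) =
    refl , balanced-swap₁₂ (balanced-∞00 q₂ (collinear-swap₁₂ C))
  coord-collinear C (near0 _) (near0 _) (near∞ _ q₃) =
    refl , balanced-swap₂₃ (balanced-swap₁₂
      (balanced-∞00 q₃ (collinear-swap₁₂ (collinear-swap₂₃ C))))
  coord-collinear C (near0 p₁) (near0 p₂) (near0 p₃) = ⊥-elim (not-all-near0 p₁ p₂ p₃ C)

  -- Reduction modulo 2 as a homomorphism

  data PointCoord : Point → Parity → ℚ → Set where
    at-∞      : PointCoord ∞ 0ℙ 0ℚ
    at-affine : ∀ {x y π z} .{e : OnCurve x y} → Coord x π z → PointCoord (affine x y e) π z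

  -- Covers the sums without a secant: adding `∞`, and adding opposite points.
  balanced-0zz : ∀ z → Balanced 0ℚ z z
  balanced-0zz z = balanced (solve 2 (λ a z →
    let t = con 0ℚ :* z :* z :- a :* (con 0ℚ :+ z :+ z) in
    t :* t := con (fromℕ 4) :* (a :* a :* (con 0ℚ :* z :+ con 0ℚ :* z :+ z :* z))) refl a z)

  -- The sum and the third intersection are reflections of each other and share their abscissa, so
  -- `coord-collinear` applies to the sum itself.
  ⊕-coord : ∀ {P Q π ρ z w} → PointCoord P π z → PointCoord Q ρ w →
            ∃[ v ] PointCoord (P ⊕ Q) (π ℙ.+ ρ) v × Balanced z w v
  ⊕-coord {w = w} at-∞ q = w , q , balanced-0zz w
  ⊕-coord {π = π} {z = z} p@(at-affine _) at-∞ =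
    z , subst (λ σ → PointCoord _ σ z) (ℙ.+-comm 0ℙ π) p , balanced-swap₁₂ (balanced-0zz z)
  ⊕-coord {π = π} {ρ} {z} {w} (at-affine {x₁} {y₁} {e = e₁} c₁) (at-affine {x₂} {y₂} {e = e₂} c₂) =
    from-sum (⊕-sum x₁ y₁ x₂ y₂ e₁ e₂)
    where
    from-sum : ∀ {R} → Sum x₁ y₁ x₂ y₂ R → ∃[ v ] PointCoord R (π ℙ.+ ρ) v × Balanced z w v
    from-sum (opposite refl _) = vertical (coord-unique c₁ c₂)
      where
      vertical : π ≡ ρ × z ≡ w → ∃[ v ] PointCoord ∞ (π ℙ.+ ρ) v × Balanced z w v
      vertical (refl , refl) = 0ℚ , subst (λ σ → PointCoord ∞ σ 0ℚ) (sym (ℙ.p+p≡0ℙ π)) at-∞ ,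
        balanced-swap₂₃ (balanced-swap₁₂ (balanced-0zz z))
    from-sum (secant {y₃ = y₃} {e = e₃} _ _ _ _ _ L) =
      let σ , v , c₃ = coord {y = y₃} (recompute (_ ≟ _) e₃)
          σ≡ , B     = coord-collinear (line⇒collinear L) c₁ c₂ c₃
      in v , at-affine (subst (λ σ → Coord _ σ v) σ≡ c₃) , B

  -- Residues of ratios of coordinates

  data Residue : Parity → ℚ → Set where
    even-residue : ∀ {r} → Even r → Residue 0ℙ r
    odd-residue  : ∀ {r} → Odd r → Residue 1ℙ r

  -- With r = z₂ / z₁ and r′ = z₃ / z₁ the balance reads
  -- (z₁² r r′ - a (1 + r + r′))² = 4 a² (r + r′ + r r′), a quadratic equation for r′
  -- over Z₍₂₎ whose leading coefficient (z₁² r - a)² is odd; hence r′ ∈ Z₍₂₎, and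
  -- 1 + r + r′ is even.
  ratio-relation : ∀ {z r r′} → z ≢ 0ℚ → Balanced z (z * r) (z * r′) →
    (z * z * r * r′ - a * (1ℚ + r + r′)) * (z * z * r * r′ - a * (1ℚ + r + r′))
    ≡ fromℕ 4 * (a * a * (r + r′ + r * r′))
  ratio-relation {z} {r} {r′} z≢0 (balanced eq) =
    x-y≡0⇒x≡y _ _ (*-cancelˡ-≡0 {z * z} (λ z²≡0 → z≢0 (x²≡0⇒x≡0 z z²≡0)) (trans
      (solve 4 (λ a z r s →
        let t = z :* z :* r :* s :- a :* (con 1ℚ :+ r :+ s)
            u = z :* (z :* r) :* (z :* s) :- a :* (z :+ z :* r :+ z :* s) in
        z :* z :* (t :* t :- con (fromℕ 4) :* (a :* a :* (r :+ s :+ r :* s))) :=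
        u :* u :- con (fromℕ 4) :* (a :* a :* (z :* (z :* r) :+ z :* (z :* s) :+ z :* r :* (z :* s))))
        refl a z r r′)
      (x≡y⇒x-y≡0 eq)))

  residue⇒local : ∀ {π r} → Residue π r → Local r
  residue⇒local (even-residue r-even) = even⇒local r-even
  residue⇒local (odd-residue r-odd)   = odd⇒local r-odd

  ratio-residue : ∀ {π z r r′} → Even z → z ≢ 0ℚ → Residue π r →
                  Balanced z (z * r) (z * r′) → Residue (π ℙ.⁻¹) r′
  ratio-residue {π} {z} {r} {r′} z-even z≢0 res B = cases res (reduction r′)
    where
    z² : Even (z * z)
    z² = even-*ʳ z-even (even⇒local z-even)

    r∈ : Local r
    r∈ = residue⇒local res

    1+r+r′-not-odd : Local r′ → ¬ Odd (1ℚ + r + r′)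
    1+r+r′-not-odd r′∈ h = even⇒¬odd
      (even-*ʳ 4-even (local-* (local-* a-local a-local) (local-+ (local-+ r∈ r′∈) (local-* r∈ r′∈))))
      (subst Odd (ratio-relation z≢0 B) (odd-* t-odd t-odd))
      where
      t-odd : Odd (z * z * r * r′ - a * (1ℚ + r + r′))
      t-odd = even-+-odd (even-*ʳ (even-*ʳ z² r∈) r′∈) (odd-neg (odd-* a-odd h))

    -- After multiplication by `s²` the left side is the square of an odd number, because the
    -- leading coefficient is odd and `s` is even, while the right side stays divisible by 4.
    r′-not-polar : ∀ s → Even s → r′ * s ≢ 1ℚ
    r′-not-polar s s-even r′s≡1 = even⇒¬odd
      (even-*ʳ 4-even (local-* (local-* a-local a-local)
        (local-* s∈ (local-+ (local-+ (local-* r∈ s∈) 1-local) (local-* r∈ 1-local)))))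
      (subst Odd (cleared r′s≡1) (odd-* t-odd t-odd))
      where
      s∈ = even⇒local s-even
      t-odd : Odd (z * z * r * 1ℚ - a * (s * (1ℚ + r) + 1ℚ))
      t-odd = even-+-odd (even-*ʳ (even-*ʳ z² r∈) 1-local)
        (odd-neg (odd-* a-odd (even-+-odd (even-*ʳ s-even (local-+ 1-local r∈)) 1-odd)))
      cleared : ∀ {u} → r′ * s ≡ u →
        (z * z * r * u - a * (s * (1ℚ + r) + u)) * (z * z * r * u - a * (s * (1ℚ + r) + u))
        ≡ fromℕ 4 * (a * a * (s * (r * s + u + r * u)))
      cleared refl = ≡-from
        (solve 5 (λ a z r r′ s →
          let u = r′ :* s
              t = z :* z :* r :* u :- a :* (s :* (con 1ℚ :+ r) :+ u)
              t′ = z :* z :* r :* r′ :- a :* (con 1ℚ :+ r :+ r′) in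
          t :* t :- con (fromℕ 4) :* (a :* a :* (s :* (r :* s :+ u :+ r :* u))) :=
          s :* s :* (t′ :* t′ :- con (fromℕ 4) :* (a :* a :* (r :+ r′ :+ r :* r′))))
          refl a z r r′ s)
        (*-diff≡0 (s * s) (ratio-relation z≢0 B))

    cases : Residue π r → Reduction r′ → Residue (π ℙ.⁻¹) r′
    cases (even-residue r-even) (isEven r′-even) =
      ⊥-elim (1+r+r′-not-odd (even⇒local r′-even) (odd-+-even (odd-+-even 1-odd r-even) r′-even))
    cases (even-residue _) (isOdd r′-odd) = odd-residue r′-odd
    cases (odd-residue _) (isEven r′-even) = even-residue r′-even
    cases (odd-residue r-odd) (isOdd r′-odd) =
      ⊥-elim (1+r+r′-not-odd (odd⇒local r′-odd) (even-+-odd (odd-+-odd 1-odd r-odd) r′-odd))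
    cases _ (isPolar s s-even r′s≡1) = ⊥-elim (r′-not-polar s s-even r′s≡1)

  point-coord-even : ∀ {P π z} → PointCoord P π z → Even z
  point-coord-even at-∞          = 0-even
  point-coord-even (at-affine c) = coord-even c

  parity-suc : ∀ n → parity (suc n) ≡ parity n ℙ.⁻¹
  parity-suc n = trans (sym (ℙ.⁻¹-involutive (parity (suc n)))) (cong ℙ._⁻¹ (ℙ.suc-homo-⁻¹ n))

  ·-coord : ∀ {P π z} → PointCoord P π z → z ≢ 0ℚ → ∀ n →
            ∃[ r ] PointCoord (n · P) (parity n ℙ.* π) (z * r) × Residue (parity n) r
  ·-coord {z = z} p z≢0 zero =
    0ℚ , subst (PointCoord ∞ 0ℙ) (sym (*-zeroʳ z)) at-∞ , even-residue 0-even
  ·-coord {P} {π} {z} p z≢0 (suc n) = step (·-coord p z≢0 n)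
    where
    instance _ = ≢-nonZero z≢0
    parities : ∀ ρ → π ℙ.+ (ρ ℙ.* π) ≡ ρ ℙ.⁻¹ ℙ.* π
    parities 0ℙ = ℙ.+-comm π 0ℙ
    parities 1ℙ = ℙ.p+p≡0ℙ π
    step : ∃[ r ] PointCoord (n · P) (parity n ℙ.* π) (z * r) × Residue (parity n) r →
           ∃[ r ] PointCoord (suc n · P) (parity (suc n) ℙ.* π) (z * r) × Residue (parity (suc n)) r
    step (r , q , res) =
      let v , s , B = ⊕-coord p q
          v≡ : v ≡ z * (v ÷ z)
          v≡ = trans (sym (÷-* v z)) (*-comm (v ÷ z) z)
      -- The quotient exists because `z` is nonzero; that it lies in Z₍₂₎ comes only from
      -- `ratio-residue`.
      in v ÷ z , subst (λ ρ → PointCoord (suc n · P) (ρ ℙ.* π) (z * (v ÷ z)) × Residue ρ (v ÷ z))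
        (sym (parity-suc n))
        (subst₂ (PointCoord (suc n · P)) (parities (parity n)) v≡ s ,
         ratio-residue (point-coord-even p) z≢0 res (subst (Balanced z (z * r)) v≡ B))

  -- Determination of the torsion points

  T-onCurve : OnCurve 0ℚ 0ℚ
  T-onCurve = solve 1 (λ a → con 0ℚ :* con 0ℚ :=
    con 0ℚ :* con 0ℚ :* con 0ℚ :+ a :* con 0ℚ :+ con 0ℚ) refl a

  T : Point
  T = affine 0ℚ 0ℚ T-onCurve

  0·z≢a : ∀ z → 0ℚ * z ≢ a
  0·z≢a z 0z≡a = a≢0 (trans (sym 0z≡a) (*-zeroˡ z))

  ∞-coord : ∀ {P π z} → PointCoord P π z → P ≡ ∞ → z ≡ 0ℚ
  ∞-coord at-∞ _ = refl

  T-coord : ∀ {P π z} → PointCoord P π z → P ≡ T → π ≡ 1ℙ × z ≡ 0ℚ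
  T-coord (at-affine (near∞ {z} _ 0z≡a)) refl = ⊥-elim (0·z≢a z 0z≡a)
  T-coord (at-affine (near0 _)) refl = refl , refl

  zero-residue : ∀ {π z r} → z ≢ 0ℚ → z * r ≡ 0ℚ → Residue π r → π ≡ 0ℙ
  zero-residue _ _ (even-residue _) = refl
  zero-residue {z = z} {r} z≢0 zr≡0 (odd-residue r-odd) =
    ⊥-elim (even⇒¬odd 0-even (subst Odd (*-cancelˡ-≡0 {z} {r} z≢0 zr≡0) r-odd))

  multiple-≢T : ∀ {P π z} → PointCoord P π z → z ≢ 0ℚ → ∀ n → n · P ≢ T
  multiple-≢T {P} {π} {z} p z≢0 n nP≡T = impossible (·-coord p z≢0 n)
    where
    impossible : ∃[ r ] PointCoord (n · P) (parity n ℙ.* π) (z * r) × Residue (parity n) r → ⊥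
    impossible (r , q , res) =
      let ρ≡1ℙ , zr≡0 = T-coord q nP≡T in
      -- `T` has parity `1ℙ`, so `parity n ℙ.* π` is `1ℙ`; but the vanishing ratio makes its first
      -- factor `0ℙ`.
      contradiction (trans (sym ρ≡1ℙ) (cong (ℙ._* π) (zero-residue z≢0 zr≡0 res))) λ ()

  multiple-≡∞⇒even : ∀ {P π z} → PointCoord P π z → z ≢ 0ℚ → ∀ n → n · P ≡ ∞ → parity n ≡ 0ℙ
  multiple-≡∞⇒even {P} {π} {z} p z≢0 n nP≡∞ = let r , q , res = ·-coord p z≢0 n in
    zero-residue z≢0 (∞-coord q nP≡∞) res

  y≡0⇒x≡0⊎x²+a≡0 : ∀ {x y} .(e : OnCurve x y) → y ≡ 0ℚ → x ≡ 0ℚ ⊎ x * x + a ≡ 0ℚ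
  y≡0⇒x≡0⊎x²+a≡0 {x} {y} e y≡0 = *≡0⇒≡0∨≡0 x (x * x + a) (trans
    (solve 2 (λ x a → x :* (x :* x :+ a) := x :* x :* x :+ a :* x :+ con 0ℚ) refl x a)
    (trans (sym (recompute (_ ≟ _) e)) (trans (cong (λ y → y * y) y≡0) (*-zeroˡ 0ℚ))))

  -- A root would be the abscissa of a second point of order two. For even `x` the value is odd; at
  -- a pole, `z²` times it is `a² + a z²`, again odd.
  x²+a≢0 : ∀ {x y} → OnCurve x y → x * x + a ≢ 0ℚ
  x²+a≢0 {x} {y} e x²+a≡0 = let _ , _ , c = coord {y = y} e in impossible c
    where
    impossible : ∀ {π z} → Coord x π z → ⊥
    impossible (near0 x-even) = even⇒¬odd 0-even
      (subst Odd x²+a≡0 (even-+-odd (even-*ʳ x-even (even⇒local x-even)) a-odd))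
    impossible (near∞ {z} z-even xz≡a) = even⇒¬odd 0-even (subst Odd (begin
      a * a + a * (z * z)              ≡⟨ cong (λ t → t * t + a * (z * z)) xz≡a ⟨
      x * z * (x * z) + a * (z * z)    ≡⟨ solve 3 (λ x z a → x :* z :* (x :* z) :+ a :* (z :* z) :=
                                            (z :* z) :* (x :* x :+ a)) refl x z a ⟩
      z * z * (x * x + a)              ≡⟨ *-≡0 (z * z) x²+a≡0 ⟩
      0ℚ                               ∎)
      (odd-+-even (odd-* a-odd a-odd) (even-*ˡ a-local (even-*ʳ z-even (even⇒local z-even)))))
      where open ≡-Reasoning

  self-opposite : ∀ Q → Q ≡ ⊖ Q → Q ≡ ∞ ⊎ Q ≡ T
  self-opposite ∞ _ = inj₁ refl
  self-opposite (affine x y e) eq =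
    [ (λ x≡0 → inj₂ (affine-cong x≡0 y≡0)) ,
      (λ x²+a≡0 → ⊥-elim (x²+a≢0 {x} {y} (recompute (_ ≟ _) e) x²+a≡0)) ]′ (y≡0⇒x≡0⊎x²+a≡0 e y≡0)
    where
    ordinate : Point → ℚ
    ordinate ∞              = 0ℚ
    ordinate (affine _ y _) = y
    y≡0 : y ≡ 0ℚ
    y≡0 = y≡-y⇒y≡0 y (cong ordinate eq)

  parity-1+k+k : ∀ k → parity (suc (k ℕ.+ k)) ≡ 1ℙ
  parity-1+k+k k = trans (parity-suc (k ℕ.+ k)) (cong ℙ._⁻¹
    (trans (ℙ.+-homo-+ k k) (ℙ.p+p≡0ℙ (parity k))))

  multiple-≢∞ : ∀ {P π z} → PointCoord P π z → z ≢ 0ℚ → ∀ n → ℕ.NonZero n → n · P ≢ ∞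
  multiple-≢∞ {P} p z≢0 = <-rec _ descend
    where
    descend : ∀ n → (∀ {m} → m ℕ.< n → ℕ.NonZero m → m · P ≢ ∞) → ℕ.NonZero n → n · P ≢ ∞
    descend n rec n≢0 nP≡∞ = cases (half n)
      where
      cases : (∃[ k ] n ≡ k ℕ.+ k) ⊎ (∃[ k ] n ≡ suc (k ℕ.+ k)) → ⊥
      cases (inj₂ (k , refl)) with () ← trans (sym (parity-1+k+k k)) (multiple-≡∞⇒even p z≢0 n nP≡∞)
      cases (inj₁ (zero , refl)) = ℕ.≢-nonZero⁻¹ 0 {{n≢0}} refl
      -- A positive `k` is less than `k + k`, and `k · P` equals its own opposite, so it is `∞` or
      -- `T`.
      cases (inj₁ (k@(suc _) , refl)) =
        [ rec (ℕ.m<m+n k ℕ.z<s) _ , multiple-≢T p z≢0 k ]′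
          (self-opposite (k · P) (·-opposite k k P nP≡∞))

  coord-0 : ∀ {x π} → Coord x π 0ℚ → x ≡ 0ℚ
  coord-0 {x} (near∞ _ x0≡a) = ⊥-elim (a≢0 (trans (sym x0≡a) (*-zeroʳ x)))
  coord-0 (near0 _) = refl

  x≡0⇒y≡0 : ∀ {x y} → OnCurve x y → x ≡ 0ℚ → y ≡ 0ℚ
  x≡0⇒y≡0 {x} {y} e x≡0 = x²≡0⇒x≡0 y (trans e
    (trans (solve 2 (λ x a → x :* x :* x :+ a :* x :+ con 0ℚ := (x :* x :+ a) :* x) refl x a)
      (*-≡0 (x * x + a) x≡0)))

  torsion⇒∞⊎T : ∀ P → IsTorsion (rationalPoints E) P → P ≡ ∞ ⊎ P ≡ T
  torsion⇒∞⊎T ∞ _ = inj₁ refl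
  torsion⇒∞⊎T (affine x y e) (n , n≢0 , nP≡∞) =
    let _ , z , c = coord {y = y} e′ in cases c (z ≟ 0ℚ)
    where
    e′ : OnCurve x y
    e′ = recompute (_ ≟ _) e
    cases : ∀ {π z} → Coord x π z → Dec (z ≡ 0ℚ) → affine x y e ≡ ∞ ⊎ affine x y e ≡ T
    cases c (no z≢0)   = ⊥-elim (multiple-≢∞ (at-affine {e = e} c) z≢0 n n≢0 nP≡∞)
    cases c (yes refl) = inj₂ (affine-cong (coord-0 c) (x≡0⇒y≡0 e′ (coord-0 c)))

  -- The torsion subgroup and its isomorphism with ℤ/2ℤ

  T⊕T≡∞ : T ⊕ T ≡ ∞
  T⊕T≡∞ = opposite-⊕ 0ℚ 0ℚ 0ℚ 0ℚ {T-onCurve} {T-onCurve} refl refl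

  ∞⊎T⇒torsion : ∀ {P} → P ≡ ∞ ⊎ P ≡ T → IsTorsion (rationalPoints E) P
  ∞⊎T⇒torsion (inj₁ P≡∞) = 1 , _ , trans (⊕-identityʳ _) P≡∞
  ∞⊎T⇒torsion (inj₂ P≡T) =
    2 , _ , trans (cong₂ _⊕_ P≡T (trans (⊕-identityʳ _) P≡T)) T⊕T≡∞

  ∞⊎T-⊕ : ∀ {P Q} → P ≡ ∞ ⊎ P ≡ T → Q ≡ ∞ ⊎ Q ≡ T → P ⊕ Q ≡ ∞ ⊎ P ⊕ Q ≡ T
  ∞⊎T-⊕ (inj₁ refl) q               = q
  ∞⊎T-⊕ (inj₂ P≡T)  (inj₁ Q≡∞)      = inj₂ (cong₂ _⊕_ P≡T Q≡∞)
  ∞⊎T-⊕ (inj₂ P≡T)  (inj₂ Q≡T)      = inj₁ (trans (cong₂ _⊕_ P≡T Q≡T) T⊕T≡∞)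

  ∞⊎T-⊖ : ∀ {P} → P ≡ ∞ ⊎ P ≡ T → ⊖ P ≡ ∞ ⊎ ⊖ P ≡ T
  ∞⊎T-⊖ (inj₁ P≡∞) = inj₁ (cong ⊖_ P≡∞)
  ∞⊎T-⊖ (inj₂ P≡T) = inj₂ (trans (cong ⊖_ P≡T) (affine-cong refl refl))

  -- Closure of torsion under addition usually rests on associativity and commutativity; here the
  -- classification `torsion⇒∞⊎T` leaves only sums of `∞` and `T` to inspect.
  isSubgroup : IsSubgroup (rationalPoints E) (IsTorsion (rationalPoints E))
  isSubgroup = record
    { ∙-closed  = λ p q → ∞⊎T⇒torsion (∞⊎T-⊕ (torsion⇒∞⊎T _ p) (torsion⇒∞⊎T _ q))
    ; ε-closed  = ∞⊎T⇒torsion (inj₁ refl)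
    ; ⁻¹-closed = λ p → ∞⊎T⇒torsion (∞⊎T-⊖ (torsion⇒∞⊎T _ p))
    }

  -- Separates `T` from `∞`; additivity is claimed for these two points only.
  isAffine : Point → Parity
  isAffine ∞              = 0ℙ
  isAffine (affine _ _ _) = 1ℙ

  isAffine-⊕ : ∀ {P Q} → P ≡ ∞ ⊎ P ≡ T → Q ≡ ∞ ⊎ Q ≡ T →
               isAffine (P ⊕ Q) ≡ isAffine P ℙ.+ isAffine Q
  isAffine-⊕ (inj₁ refl) _ = refl
  isAffine-⊕ (inj₂ P≡T) (inj₁ Q≡∞) = trans (cong isAffine (cong₂ _⊕_ P≡T Q≡∞))
    (sym (cong₂ (λ P Q → isAffine P ℙ.+ isAffine Q) P≡T Q≡∞))
  isAffine-⊕ (inj₂ P≡T) (inj₂ Q≡T) = trans (cong isAffine (trans (cong₂ _⊕_ P≡T Q≡T) T⊕T≡∞))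
    (sym (cong₂ (λ P Q → isAffine P ℙ.+ isAffine Q) P≡T Q≡T))

  isAffine-⊖ : ∀ P → isAffine (⊖ P) ≡ isAffine P
  isAffine-⊖ ∞              = refl
  isAffine-⊖ (affine _ _ _) = refl

  isAffine-injective : ∀ {P Q} → P ≡ ∞ ⊎ P ≡ T → Q ≡ ∞ ⊎ Q ≡ T →
                       isAffine P ≡ isAffine Q → P ≡ Q
  isAffine-injective (inj₁ P≡∞) (inj₁ Q≡∞) _ = trans P≡∞ (sym Q≡∞)
  isAffine-injective (inj₂ P≡T) (inj₂ Q≡T) _ = trans P≡T (sym Q≡T)
  isAffine-injective (inj₁ P≡∞) (inj₂ Q≡T) eq = contradiction
    (trans (cong isAffine (sym P≡∞)) (trans eq (cong isAffine Q≡T))) λ ()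
  isAffine-injective (inj₂ P≡T) (inj₁ Q≡∞) eq = contradiction
    (trans (cong isAffine (sym P≡T)) (trans eq (cong isAffine Q≡∞))) λ ()

  torsion≅ℤ/2ℤ : subgroup (rationalPoints E) isSubgroup ≅ ℤ/2ℤ
  torsion≅ℤ/2ℤ = (λ (P , _) → isAffine P) , record
    { isGroupMonomorphism = record
      { isGroupHomomorphism = record
        { isMonoidHomomorphism = record
          { isMagmaHomomorphism = record
            { isRelHomomorphism = record { cong = cong isAffine }
            ; homo = λ (P , p) (Q , q) → isAffine-⊕ (torsion⇒∞⊎T P p) (torsion⇒∞⊎T Q q)
            }
          ; ε-homo = refl
          }
        ; ⁻¹-homo = λ (P , _) → isAffine-⊖ P
        }
      ; injective = λ {(P , p)} {(Q , q)} → isAffine-injective (torsion⇒∞⊎T P p) (torsion⇒∞⊎T Q q)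
      }
    ; surjective = λ where
        0ℙ → (∞ , ∞⊎T⇒torsion (inj₁ refl)) , cong isAffine
        1ℙ → (T , ∞⊎T⇒torsion (inj₂ refl)) , cong isAffine
    }

-- The curve of the theorem

5pq≡3mod4 : ∀ p q → p % 40 ≡ 33 → q % 40 ≡ 7 → ∃[ k ] 5 ℕ.* p ℕ.* q ≡ 3 ℕ.+ 4 ℕ.* k
-- The quotient by 4 of `5 (33 + 40P)(7 + 40Q) - 3`; its constant term comes from
-- `1155 = 3 + 4 · 288`.
5pq≡3mod4 p q p≡33 q≡7 = 288 ℕ.+ 350 ℕ.* P ℕ.+ 1650 ℕ.* Q ℕ.+ 2000 ℕ.* (P ℕ.* Q) , trans
  (cong₂ (λ p q → 5 ℕ.* p ℕ.* q) (expand p p≡33) (expand q q≡7))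
  (ℕSolver.solve 2 (λ P Q →
    lit 5 ⊛ (lit 33 ⊞ P ⊛ lit 40) ⊛ (lit 7 ⊞ Q ⊛ lit 40) ⊜
    lit 3 ⊞ lit 4 ⊛ (lit 288 ⊞ lit 350 ⊛ P ⊞ lit 1650 ⊛ Q ⊞ lit 2000 ⊛ (P ⊛ Q)))
    refl P Q)
  where
  open module ℕSolver = ℕ.+-*-Solver using ()
    renaming (_:+_ to _⊞_; _:*_ to _⊛_; _:=_ to _⊜_; con to lit)
  P = p ℕ./ 40
  Q = q ℕ./ 40
  expand : ∀ n {r} → n % 40 ≡ r → n ≡ r ℕ.+ n ℕ./ 40 ℕ.* 40
  expand n refl = m≡m%n+[m/n]*n n 40

-D≡1mod4 : ∀ {D} k → D ≡ 3 ℕ.+ 4 ℕ.* k → - fromℕ D ≡ 1ℚ + fromℕ 4 * - (1ℚ + fromℕ k)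
-D≡1mod4 k refl = trans
  (cong -_ (trans (fromℕ-+ 3 (4 ℕ.* k)) (cong (λ t → fromℕ 3 + t) (fromℕ-* 4 k))))
  (solve 1 (λ k → :- (con (fromℕ 3) :+ con (fromℕ 4) :* k) :=
    con 1ℚ :+ con (fromℕ 4) :* (:- (con 1ℚ :+ k))) refl (fromℕ k))

theorem1p3 :
    ∀ (p q : ℕ) (p-prime : Prime p) (q-prime : Prime q) → p ≢ q →
    p % 40 ≡ 33 → q % 40 ≡ 7 →
    let E⟨ℚ⟩ = rationalPoints E[ p-prime , q-prime ] in
    Σ[ tors ∈ IsSubgroup E⟨ℚ⟩ (IsTorsion E⟨ℚ⟩) ]
      subgroup E⟨ℚ⟩ tors ≅ ℤ/2ℤ
theorem1p3 p q p-prime q-prime _ p≡33 q≡7 =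
  let k , D≡ = 5pq≡3mod4 p q p≡33 q≡7
      open CurveArithmetic (EllipticCurve.a E[ p-prime , q-prime ])
        -- Here `κ` is `- (1 + k)`, since `- (3 + 4k) = 1 - 4 (1 + k)`.
        (local-neg (local-+ 1-local (fromℕ-local k))) (-D≡1mod4 k D≡)
        (EllipticCurve.Δ≢0 E[ p-prime , q-prime ])
  in isSubgroup , torsion≅ℤ/2ℤ
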